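{- Let $q$ be a prime power and let $n$ and $d$ be odd integers satisfying $1\le d\le n$. Let $\operatorname{Tr}:\mathbb{F}_{q^{2n}}\to\mathbb{F}_{q^2}$, $\operatorname{Tr}(x)=\sum_{k=0}^{n-1}x^{q^{2k}}$. For $a_0\in\mathbb{F}_{q^n}$ and $a_1,\dots,a_{(n-d)/2}\in\mathbb{F}_{q^{2n}}$ define \[ H(x,y)=\operatorname{Tr}\bigg(a_0xy^{q^n}+\sum_{j=1}^{(n-d)/2}\big(a_jxy^{q^{n-2j}}+(a_j)^qx^{q^{n-2j+1}}y^q\big)\bigg),\qquad x,y\in\mathbb{F}_{q^{2n}}. \] Then, as $a_0$ ranges over $\mathbb{F}_{q^n}$ and $a_1,\dots,a_{(n-d)/2}$ range over $\mathbb{F}_{q^{2n}}$, these mappings $H$ are Hermitian forms on $\mathbb{F}_{q^{2n}}$ (viewed as an $n$-dimensional vector space over $\mathbb{F}_{q^2}$) and, identified with matrices in $X(n,q)$, they form an additive $d$-code in $X(n,q)$ of size $q^{n(n-d+1)}$.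
   Context: $X(n,q)$ is the set of $n\times n$ Hermitian matrices over $\mathbb{F}_{q^2}$ (matrices $A$ with $A^*=A$, where $A^*$ is the transpose of the matrix obtained by applying $x\mapsto x^q$ to each entry). A Hermitian form on an $n$-dimensional $\mathbb{F}_{q^2}$-vector space $V$ is a map $H:V\times V\to\mathbb{F}_{q^2}$ that is $\mathbb{F}_{q^2}$-linear in the first argument and satisfies $H(y,x)=H(x,y)^q$. Fixing a basis $\xi_1,\dots,\xi_n$ of $V$, $H$ is identified with the Hermitian matrix $(H(\xi_i,\xi_j))_{i,j}$; this is a bijection between Hermitian forms and $X(n,q)$, and the matrix rank equals $n-\dim\{x\in V:H(x,y)=0\ \forall y\}$. $\mathbb{F}_{q^n}$ is regarded as the subfield of $\mathbb{F}_{q^{2n}}$ of that order. A nonempty subset $Y\subseteq X(n,q)$ is a $d$-code if $\operatorname{rank}(A-B)\ge d$ for all distinct $A,B\in Y$; it is additive if it is a subgroup of $(X(n,q),+)$. -}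

module Defs where

open import Level using (Level; _⊔_) renaming (suc to lsuc)
open import Algebra.Bundles using (CommutativeRing)
open import Algebra.Module.Bundles using (LeftModule)
import Algebra.Module.Construct.TensorUnit as TensorUnit
import Algebra.Properties.CommutativeMonoid.Sum as MonoidSum
import Algebra.Properties.Semiring.Exp as Exp
open import Data.Fin.Base using (Fin; toℕ)
open import Data.Nat.Base as ℕ using (ℕ; suc; _∸_; _≤_)
open import Data.Nat.DivMod using (_/_)
open import Data.Nat.Primality using (Prime)
open import Data.Product.Base using (Σ; ∃; ∃₂; _×_; _,_; proj₁; proj₂)
open import Data.Vec.Functional using (Vector)
open import Function.Bundles using (Bijection)
open import Relation.Binary.Bundles using (Setoid)
import Relation.Binary.Construct.On as On
open import Relation.Binary.PropositionalEquality.Core using (_≡_)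
import Relation.Binary.PropositionalEquality.Properties as ≡
open import Relation.Nullary.Negation.Core using (¬_)
open import Relation.Unary using (Pred; _∈_; _⊆_)

private
  variable
    a b c ℓ m ℓm p : Level

IsPrimePower : ℕ → Set
IsPrimePower q = ∃₂ λ r k → Prime r × 1 ≤ k × q ≡ r ℕ.^ k

Odd : ℕ → Set
Odd n = ∃ λ k → n ≡ 2 ℕ.* k ℕ.+ 1

HasSize : Setoid a ℓ → ℕ → Set (a ⊔ ℓ)
HasSize S N = Bijection S (≡.setoid (Fin N))

-- A subset of a setoid; membership proofs are ignored by the equality.
subsetoid : (S : Setoid a ℓ) → Pred (Setoid.Carrier S) p → Setoid (a ⊔ p) ℓ
subsetoid S P = On.setoid {B = ∃ P} S proj₁

record Field c ℓ : Set (lsuc (c ⊔ ℓ)) where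
  field
    commutativeRing : CommutativeRing c ℓ
  open CommutativeRing commutativeRing public
  field
    1≉0     : ¬ (1# ≈ 0#)
    inverse : ∀ x → ¬ (x ≈ 0#) → ∃ λ y → x * y ≈ 1#

record Subfield (F : Field c ℓ) p : Set (c ⊔ ℓ ⊔ lsuc p) where
  open Field F using (Carrier; _≈_; _+_; _*_; -_; 0#; 1#)
  field
    Member    : Pred Carrier p
    resp      : ∀ {x y} → x ≈ y → x ∈ Member → y ∈ Member
    0∈        : 0# ∈ Member
    1∈        : 1# ∈ Member
    +-closed  : ∀ {x y} → x ∈ Member → y ∈ Member → (x + y) ∈ Member
    *-closed  : ∀ {x y} → x ∈ Member → y ∈ Member → (x * y) ∈ Member
    neg-closed : ∀ {x} → x ∈ Member → (- x) ∈ Member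
    inv-closed : ∀ {x y} → x ∈ Member → x * y ≈ 1# → y ∈ Member

  asField : Field (c ⊔ p) ℓ
  asField = record
    { commutativeRing = record
      { Carrier = ∃ Member
      ; _≈_ = λ x y → proj₁ x ≈ proj₁ y
      ; _+_ = λ { (x , x∈) (y , y∈) → x + y , +-closed x∈ y∈ }
      ; _*_ = λ { (x , x∈) (y , y∈) → x * y , *-closed x∈ y∈ }
      ; -_  = λ { (x , x∈) → - x , neg-closed x∈ }
      ; 0#  = 0# , 0∈
      ; 1#  = 1# , 1∈
      ; isCommutativeRing = record
        { isRing = record
          { +-isAbelianGroup = record
            { isGroup = record
              { isMonoid = record
                { isSemigroup = record
                  { isMagma = record
                    { isEquivalence = On.isEquivalence proj₁ F.isEquivalence
                    ; ∙-cong = F.+-cong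
                    }
                  ; assoc = λ x y z → F.+-assoc (proj₁ x) (proj₁ y) (proj₁ z)
                  }
                ; identity = (λ x → F.+-identityˡ (proj₁ x)) , (λ x → F.+-identityʳ (proj₁ x))
                }
              ; inverse = (λ x → F.-‿inverseˡ (proj₁ x)) , (λ x → F.-‿inverseʳ (proj₁ x))
              ; ⁻¹-cong = F.-‿cong
              }
            ; comm = λ x y → F.+-comm (proj₁ x) (proj₁ y)
            }
          ; *-cong = F.*-cong
          ; *-assoc = λ x y z → F.*-assoc (proj₁ x) (proj₁ y) (proj₁ z)
          ; *-identity = (λ x → F.*-identityˡ (proj₁ x)) , (λ x → F.*-identityʳ (proj₁ x))
          ; distrib = (λ x y z → F.distribˡ (proj₁ x) (proj₁ y) (proj₁ z))
                    , (λ x y z → F.distribʳ (proj₁ x) (proj₁ y) (proj₁ z))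
          }
        ; *-comm = λ x y → F.*-comm (proj₁ x) (proj₁ y)
        }
      }
    ; 1≉0 = F.1≉0
    ; inverse = λ { (x , x∈) x≉0 → let (y , xy≈1) = F.inverse x x≉0 in
                    (y , inv-closed x∈ xy≈1) , xy≈1 }
    }
    where module F = Field F

HasOrder : Field c ℓ → ℕ → Set (c ⊔ ℓ)
HasOrder F = HasSize (Field.setoid F)

VectorSpace : Field c ℓ → (m ℓm : Level) → Set (c ⊔ ℓ ⊔ lsuc (m ⊔ ℓm))
VectorSpace k = LeftModule (Field.ring k)

power : (k : Field c ℓ) → VectorSpace k m ℓm → ℕ → VectorSpace k m ℓm
power k V n = record
  { Carrierᴹ = Vector V.Carrierᴹ n
  ; _≈ᴹ_ = λ u v → ∀ i → u i V.≈ᴹ v i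
  ; _+ᴹ_ = λ u v i → u i V.+ᴹ v i
  ; _*ₗ_ = λ s v i → s V.*ₗ v i
  ; 0ᴹ   = λ _ → V.0ᴹ
  ; -ᴹ_  = λ v i → V.-ᴹ (v i)
  ; isLeftModule = record
    { isLeftSemimodule = record
      { +ᴹ-isCommutativeMonoid = record
        { isMonoid = record
          { isSemigroup = record
            { isMagma = record
              { isEquivalence = record
                { refl  = λ _ → V.≈ᴹ-refl
                ; sym   = λ e i → V.≈ᴹ-sym (e i)
                ; trans = λ e f i → V.≈ᴹ-trans (e i) (f i)
                }
              ; ∙-cong = λ e f i → V.+ᴹ-cong (e i) (f i)
              }
            ; assoc = λ u v w i → V.+ᴹ-assoc (u i) (v i) (w i)
            }
          ; identity = (λ v i → V.+ᴹ-identityˡ (v i)) , (λ v i → V.+ᴹ-identityʳ (v i))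
          }
        ; comm = λ u v i → V.+ᴹ-comm (u i) (v i)
        }
      ; isPreleftSemimodule = record
        { *ₗ-cong      = λ e f i → V.*ₗ-cong e (f i)
        ; *ₗ-zeroˡ     = λ v i → V.*ₗ-zeroˡ (v i)
        ; *ₗ-distribʳ  = λ v s t i → V.*ₗ-distribʳ (v i) s t
        ; *ₗ-identityˡ = λ v i → V.*ₗ-identityˡ (v i)
        ; *ₗ-assoc     = λ s t v i → V.*ₗ-assoc s t (v i)
        ; *ₗ-zeroʳ     = λ s i → V.*ₗ-zeroʳ s
        ; *ₗ-distribˡ  = λ s u v i → V.*ₗ-distribˡ s (u i) (v i)
        }
      }
    ; -ᴹ‿cong    = λ e i → V.-ᴹ‿cong (e i)
    ; -ᴹ‿inverse = (λ v i → V.-ᴹ‿inverseˡ (v i)) , (λ v i → V.-ᴹ‿inverseʳ (v i))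
    }
  }
  where module V = LeftModule V

module _ (k : Field c ℓ) (V : VectorSpace k m ℓm) where
  open Field k using (Carrier; _≈_; 0#)
  open LeftModule V using (Carrierᴹ; _≈ᴹ_; _*ₗ_; 0ᴹ; +ᴹ-commutativeMonoid)
  open MonoidSum +ᴹ-commutativeMonoid using (sum-syntax)

  linearCombination : ∀ {r} → Vector Carrier r → Vector Carrierᴹ r → Carrierᴹ
  linearCombination {r} s v = ∑[ i < r ] (s i *ₗ v i)

  Span : ∀ {r} → Vector Carrierᴹ r → Pred Carrierᴹ (c ⊔ ℓm)
  Span v x = ∃ λ s → x ≈ᴹ linearCombination s v

  LinearlyIndependent : ∀ {r} → Vector Carrierᴹ r → Set (c ⊔ ℓ ⊔ ℓm)
  LinearlyIndependent v = ∀ s → linearCombination s v ≈ᴹ 0ᴹ → ∀ i → s i ≈ 0#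

  IsBasis : ∀ {r} → Vector Carrierᴹ r → Set (c ⊔ ℓ ⊔ m ⊔ ℓm)
  IsBasis v = LinearlyIndependent v × (∀ x → x ∈ Span v)

overSubfield : (F : Field c ℓ) (E : Subfield F p) → VectorSpace (Subfield.asField E) c ℓ
overSubfield F E = record
  { Carrierᴹ = F.Carrier
  ; _≈ᴹ_ = F._≈_
  ; _+ᴹ_ = F._+_
  ; _*ₗ_ = λ s x → proj₁ s F.* x
  ; 0ᴹ   = F.0#
  ; -ᴹ_  = F.-_
  ; isLeftModule = record
    { isLeftSemimodule = record
      { +ᴹ-isCommutativeMonoid = F.+-isCommutativeMonoid
      ; isPreleftSemimodule = record
        { *ₗ-cong      = F.*-cong
        ; *ₗ-zeroˡ     = F.zeroˡ
        ; *ₗ-distribʳ  = λ x s t → F.distribʳ x (proj₁ s) (proj₁ t)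
        ; *ₗ-identityˡ = F.*-identityˡ
        ; *ₗ-assoc     = λ s t x → F.*-assoc (proj₁ s) (proj₁ t) x
        ; *ₗ-zeroʳ     = λ s → F.zeroʳ (proj₁ s)
        ; *ₗ-distribˡ  = λ s x y → F.distribˡ (proj₁ s) x y
        }
      }
    ; -ᴹ‿cong    = F.-‿cong
    ; -ᴹ‿inverse = F.-‿inverse
    }
  }
  where module F = Field F

-- Conjugation is x ↦ x ^ q, so k is meant to have order q².
module Hermitian (k : Field c ℓ) (q : ℕ) where
  open Field k using (Carrier; _≈_; _+_; _*_; semiring; ring)
  open Exp semiring using (_^_)

  record IsHermitianForm (V : VectorSpace k m ℓm)
      (H : LeftModule.Carrierᴹ V → LeftModule.Carrierᴹ V → Carrier) : Set (c ⊔ ℓ ⊔ m ⊔ ℓm) where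
    open LeftModule V
    field
      cong        : ∀ {x x′ y y′} → x ≈ᴹ x′ → y ≈ᴹ y′ → H x y ≈ H x′ y′
      additive    : ∀ x x′ y → H (x +ᴹ x′) y ≈ H x y + H x′ y
      homogeneous : ∀ s x y → H (s *ₗ x) y ≈ s * H x y
      hermitian   : ∀ x y → H y x ≈ H x y ^ q

  coordinateSpace : ℕ → VectorSpace k c ℓ
  coordinateSpace n = power k (TensorUnit.leftModule {R = ring}) n

  matrixSpace : ℕ → VectorSpace k c ℓ
  matrixSpace n = power k (coordinateSpace n) n

  Matrix : ℕ → Set c
  Matrix n = LeftModule.Carrierᴹ (matrixSpace n)

  X : ∀ n → Pred (Matrix n) ℓ
  X n A = ∀ i j → A j i ≈ A i j ^ q

  -- The row space of A has a basis of r vectors.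
  HasRank : ∀ {n} → Matrix n → ℕ → Set (c ⊔ ℓ)
  HasRank {n} A r = Σ (Vector (Vector Carrier n) r) λ v →
    LinearlyIndependent k (coordinateSpace n) v ×
    (∀ i → v i ∈ Span k (coordinateSpace n) A) ×
    (∀ i → A i ∈ Span k (coordinateSpace n) v)

  matrixOf : ∀ {v : Level} {V : Set v} {n} → Vector V n → (V → V → Carrier) → Matrix n
  matrixOf ξ H i j = H (ξ i) (ξ j)

  module _ {n : ℕ} where
    open LeftModule (matrixSpace n)

    record IsCode (d : ℕ) (Y : Pred (Matrix n) p) : Set (c ⊔ ℓ ⊔ p) where
      field
        hermitian : Y ⊆ X n
        nonempty  : ∃ Y
        distance  : ∀ A B → A ∈ Y → B ∈ Y → ¬ (A ≈ᴹ B) →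
                    ∃ λ r → HasRank (A +ᴹ -ᴹ B) r × d ≤ r

    record IsAdditive (Y : Pred (Matrix n) p) : Set (c ⊔ p) where
      field
        zero-closed : 0ᴹ ∈ Y
        +-closed    : ∀ A B → A ∈ Y → B ∈ Y → (A +ᴹ B) ∈ Y
        neg-closed  : ∀ A → A ∈ Y → (-ᴹ A) ∈ Y

    HasCardinality : Pred (Matrix n) p → ℕ → Set (c ⊔ ℓ ⊔ p)
    HasCardinality Y = HasSize (subsetoid ≈ᴹ-setoid Y)

-- F, E and K are meant to have orders q²ⁿ, q² and qⁿ.
module Construction {p₁ p₂} (F : Field c ℓ) (E : Subfield F p₁) (K : Subfield F p₂)
    (q n d : ℕ) where
  open Field F using (Carrier; _≈_; _+_; _*_; semiring; +-commutativeMonoid)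
  open Exp semiring using (_^_)
  open MonoidSum +-commutativeMonoid using (sum-syntax)

  𝔽q² : Field (c ⊔ p₁) ℓ
  𝔽q² = Subfield.asField E

  V : VectorSpace 𝔽q² c ℓ
  V = overSubfield F E

  -- The trace as a map F → F; that it takes values in E is not built in.
  Tr : Carrier → Carrier
  Tr x = ∑[ k < n ] (x ^ (q ℕ.^ (2 ℕ.* toℕ k)))

  record Params : Set (c ⊔ p₂) where
    field
      a₀ : Field.Carrier (Subfield.asField K)
      as : Vector Carrier ((n ∸ d) / 2)

  -- as i is the coefficient a_j with j = index i, for 1 ≤ j ≤ (n-d)/2.
  index : Fin ((n ∸ d) / 2) → ℕ
  index i = suc (toℕ i)

  H : Params → Carrier → Carrier → Carrier
  H θ x y = Tr
    (proj₁ a₀ * x * y ^ (q ℕ.^ n)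
      + ∑[ i < (n ∸ d) / 2 ]
          (as i * x * y ^ (q ℕ.^ (n ∸ 2 ℕ.* index i))
            + as i ^ q * x ^ (q ℕ.^ (n ∸ 2 ℕ.* index i ℕ.+ 1)) * y ^ q))
    where open Params θ

  -- B is H θ, with its values regarded as elements of E.
  Realises : (Carrier → Carrier → Field.Carrier 𝔽q²) → Params → Set (c ⊔ ℓ)
  Realises B θ = ∀ x y → proj₁ (B x y) ≈ H θ x y

  open Hermitian 𝔽q² q public

  Y : Vector Carrier n → Pred (Matrix n) (c ⊔ ℓ ⊔ p₁ ⊔ p₂)
  Y ξ A = ∃₂ λ θ B → Realises B θ × LeftModule._≈ᴹ_ (matrixSpace n) A (matrixOf ξ B)

{-# OPTIONS --safe #-}

-- Write φ m x = x^(q^m) and e = (n - d)/2. Moving Frobenius powers across the trace turns H(y, x)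
-- into Tr(y L(x)), where L is a q²-linearized polynomial in φ d x whose 2e + 1 = n - d + 1
-- coefficients are a₀, the a_j and conjugates of the a_j. A linearized polynomial with m
-- coefficients that vanishes on m vectors independent over 𝔽q² is zero: divide it on the right by
-- x ↦ x^(q²) - b x, which kills one of the vectors and keeps the images of the others independent.
-- Applied to y ↦ Tr(y w) this shows that the trace form is nondegenerate, so L vanishes on the
-- radical of H; applied to L it shows that the radical of a nonzero H has dimension at most n - d.
-- That bounds the rank from below, and makes (a₀, a₁, …) ↦ H injective, which gives the size.
module Submission where

open import Defs
open import Algebra.Bundles using (CommutativeMonoid)
open import Algebra.Module.Bundles using (LeftModule)
import Algebra.Module.Properties.LeftModule as LeftModuleProperties
import Algebra.Properties.CommutativeMonoid.Sum as MonoidSum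
import Algebra.Properties.CommutativeSemigroup as CommutativeSemigroupProperties
import Algebra.Properties.CommutativeSemiring.Binomial as Binomial
import Algebra.Properties.CommutativeSemiring.Exp as Exp
import Algebra.Properties.Group as GroupProperties
import Algebra.Properties.Ring as RingProperties
import Algebra.Properties.Semiring.Mult as Mult
import Algebra.Properties.Semiring.Sum as SemiringSum
open import Data.Fin.Base using (Fin; zero; suc; toℕ; fromℕ; fromℕ<; opposite; punchIn; _↑ˡ_; _↑ʳ_;
  combine; remQuot; finToFun; funToFin)
open import Data.Fin.Permutation using (Permutation; permutation; reverse)
import Data.Fin.Properties as Fin
open import Data.Nat.Base as ℕ using (ℕ; zero; suc; z≤n; s≤s; _∸_; _!)
open import Data.Nat.Combinatorics using (_C_; nCn≡1; nCk≡n!/k![n-k]!; k![n∸k]!∣n!)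
open import Data.Nat.Divisibility using (_∣_; _∤_; divides; ∣1⇒≡1; ∣⇒≤; m∣m*n)
open import Data.Nat.DivMod using (_/_; m*n/n≡m; m/n*n≡m)
open import Data.Nat.Primality using (Prime; ¬prime[0]; euclidsLemma; prime⇒nonTrivial)
import Data.Nat.Properties as ℕ
open import Data.Nat.Solver using (module +-*-Solver)
open import Data.Product.Base using (∃; _×_; _,_; proj₁; proj₂)
open import Data.Sum.Base using (inj₁; inj₂)
open import Data.Vec.Base using (Vec; []; replicate) renaming (_∷_ to _∷ᵛ_)
open import Data.Vec.Functional using (Vector; _∷_; _++_; removeAt)
open import Data.Vec.Functional.Properties using (lookup-++ˡ; lookup-++ʳ)
open import Function.Base using (_∘_)
open import Function.Bundles using (Bijection)
open import Level using (Level; _⊔_)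
open import Relation.Binary.Bundles using (Setoid)
open import Relation.Binary.Definitions using (Decidable)
open import Relation.Binary.PropositionalEquality as ≡ using (_≡_; _≢_; _≗_)
import Relation.Binary.Reasoning.Setoid as SetoidReasoning
open import Relation.Nullary using (¬_; Dec; yes; no; contradiction)
open import Relation.Nullary.Decidable.Core using (map′)
open import Relation.Unary using (_∈_)

-- The exponents are governed by parity. The trace is unchanged by `φ 2`, so under it only the
-- parity of a Frobenius exponent counts. As `n` is odd, conjugation `φ 1` acts under the trace like
-- `φ n`, which fixes `a₀`, and like `φ (n + 2j)`, which undoes `φ (n - 2j)` for every `j`. The
-- exponents in `L` are therefore `n - 2j`, `n` and `n + 2j` with `1 ≤ j ≤ e`, that is `d + 2k` for
-- `0 ≤ k ≤ 2e`: an unbroken run of powers of `x ↦ x^(q²)` applied after `φ d`. The three fields are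
-- abstract and known only by their orders. Counting over enumerations recovers what the argument
-- uses: `x ^ N ≈ x`, the characteristic, and `E` as the fixed set of `φ 2`. The same enumerations
-- decide equality and membership in a span, so that a rank can be exhibited constructively.

private
  variable
    c ℓ m ℓm p p₁ p₂ : Level

-- Prime divisors of binomial coefficients

prime⇒1< : ∀ {r} → Prime r → 1 ℕ.< r
prime⇒1< {r} pr = ℕ.nonTrivial⇒n>1 r {{prime⇒nonTrivial pr}}

prime∤! : ∀ {r k} → Prime r → k ℕ.< r → r ∤ k !
prime∤! {r} {zero} pr k<r r∣1 = contradiction (∣1⇒≡1 r∣1) (ℕ.>⇒≢ (prime⇒1< pr))
prime∤! {r} {suc k} pr k<r r∣ with euclidsLemma (suc k) (k !) pr r∣
... | inj₁ r∣1+k = contradiction (∣⇒≤ r∣1+k) (ℕ.<⇒≱ k<r)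
... | inj₂ r∣k!  = prime∤! pr (ℕ.<-trans (ℕ.n<1+n k) k<r) r∣k!

-- As a prime, `r` divides some factor of `r ! = (r C k) * (k ! * (r ∸ k) !)`, and both factorials
-- are built from numbers smaller than `r`.
prime∣C : ∀ {r k} → Prime r → 0 ℕ.< k → k ℕ.< r → r ∣ r C k
prime∣C {r} {k} pr 0<k k<r with euclidsLemma (r C k) (k ! ℕ.* (r ∸ k) !) pr r∣C*k![r∸k]!
  where
  instance _ = ℕ._!*_!≢0 k (r ∸ k)
  r∣r! : ∀ r → Prime r → r ∣ r !
  r∣r! zero    p = contradiction p ¬prime[0]
  r∣r! (suc r) p = m∣m*n (r !)
  r∣C*k![r∸k]! : r ∣ (r C k) ℕ.* (k ! ℕ.* (r ∸ k) !)
  r∣C*k![r∸k]! = ≡.subst (r ∣_) (≡.sym (≡.trans (≡.cong (ℕ._* (k ! ℕ.* (r ∸ k) !)) (nCk≡n!/k![n-k]! (ℕ.<⇒≤ k<r)))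
    (m/n*n≡m (k![n∸k]!∣n! (ℕ.<⇒≤ k<r))))) (r∣r! r pr)
... | inj₁ r∣C = r∣C
... | inj₂ r∣  with euclidsLemma (k !) ((r ∸ k) !) pr r∣
... | inj₁ r∣k! = contradiction r∣k! (prime∤! pr k<r)
... | inj₂ r∣k! = contradiction r∣k! (prime∤! pr (ℕ.∸-monoʳ-< {r} 0<k (ℕ.<⇒≤ k<r)))

-- Finite sums in a commutative monoid

module _ (M : CommutativeMonoid c ℓ) where
  open CommutativeMonoid M
  open MonoidSum M

  sum-zero : ∀ {n} (t : Vector Carrier n) → (∀ i → t i ≈ ε) → sum t ≈ ε
  sum-zero {n} t t≈ε = trans (sum-cong-≋ t≈ε) (sum-replicate-zero n)

  sum-single : ∀ {n} (i : Fin n) (t : Vector Carrier n) → (∀ j → j ≢ i → t j ≈ ε) → sum t ≈ t i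
  sum-single {suc n} i t t≈ε = begin
    sum t                       ≈⟨ sum-remove {i = i} t ⟩
    t i ∙ sum (removeAt t i)    ≈⟨ ∙-congˡ (sum-zero (removeAt t i) λ j → t≈ε (punchIn i j) (Fin.punchInᵢ≢i i j)) ⟩
    t i ∙ ε                     ≈⟨ identityʳ (t i) ⟩
    t i                         ∎
    where open SetoidReasoning setoid

  sum-↑ : ∀ m {n} (t : Vector Carrier (m ℕ.+ n)) → sum t ≈ sum (λ i → t (i ↑ˡ n)) ∙ sum (λ i → t (m ↑ʳ i))
  sum-↑ zero    t = sym (identityˡ _)
  sum-↑ (suc m) t = trans (∙-congˡ (sum-↑ m (t ∘ suc))) (sym (assoc _ _ _))

  -- The end terms are added on opposite sides because a monoid has no subtraction. With Frobenius
  -- images for `g`, this is the cyclic shift of the summands of a trace.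
  sum-telescope : ∀ n (g : ℕ → Carrier) →
    sum {n} (λ k → g (suc (toℕ k))) ∙ g 0 ≈ sum {n} (λ k → g (toℕ k)) ∙ g n
  sum-telescope zero    g = refl
  sum-telescope (suc n) g = begin
    g 1 ∙ sum {n} (λ k → g (suc (suc (toℕ k)))) ∙ g 0      ≈⟨ comm _ _ ⟩
    g 0 ∙ (g 1 ∙ sum {n} (λ k → g (suc (suc (toℕ k)))))    ≈⟨ ∙-congˡ (trans (comm _ _) (sum-telescope n (g ∘ suc))) ⟩
    g 0 ∙ (sum {n} (λ k → g (suc (toℕ k))) ∙ g (suc n))    ≈⟨ assoc _ _ _ ⟨
    g 0 ∙ sum {n} (λ k → g (suc (toℕ k))) ∙ g (suc n)      ∎
    where open SetoidReasoning setoid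

-- Enumerations of finite setoids

module FiniteSetoid (S : Setoid c ℓ) {N : ℕ} (size : HasSize S N) where
  open Setoid S
  open Bijection size using (injective; cong; strictlySurjective) renaming (to to index) public

  enum : Fin N → Carrier
  enum i = proj₁ (strictlySurjective i)

  index-enum : ∀ i → index (enum i) ≡ i
  index-enum i = proj₂ (strictlySurjective i)

  enum-index : ∀ x → enum (index x) ≈ x
  enum-index x = injective (index-enum (index x))

  enum-injective : ∀ {i j} → enum i ≈ enum j → i ≡ j
  enum-injective {i} {j} e = ≡.trans (≡.sym (index-enum i)) (≡.trans (cong e) (index-enum j))

  _≟_ : Decidable _≈_
  x ≟ y = map′ injective cong (index x Fin.≟ index y)

  module _ (M : CommutativeMonoid p₁ p₂) where
    open CommutativeMonoid M using () renaming (Carrier to B; _≈_ to _≈ᴹ_)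
    private module M = CommutativeMonoid M
    open MonoidSum M

    -- Mutually inverse `f` and `g` become a permutation of the indices after conjugation with the
    -- enumeration. The target monoid is arbitrary, so the lemma serves sums and products of field
    -- elements alike.
    sum-enum-permute : (h : Carrier → B) → (∀ {x y} → x ≈ y → h x ≈ᴹ h y) →
      (f g : Carrier → Carrier) → (∀ {x y} → x ≈ y → f x ≈ f y) → (∀ {x y} → x ≈ y → g x ≈ g y) →
      (∀ x → f (g x) ≈ x) → (∀ x → g (f x) ≈ x) →
      sum (h ∘ enum) ≈ᴹ sum (h ∘ f ∘ enum)
    sum-enum-permute h h-cong f g f-cong g-cong fg gf =
      M.trans (sum-permute (h ∘ enum) π) (sum-cong-≋ λ i → h-cong (enum-index (f (enum i))))
      where
      conj-inverse : (f g : Carrier → Carrier) → (∀ {x y} → x ≈ y → f x ≈ f y) → (∀ x → f (g x) ≈ x) →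
        ∀ i → index (f (enum (index (g (enum i))))) ≡ i
      conj-inverse f g f-cong fg i =
        ≡.trans (cong (trans (f-cong (enum-index _)) (fg _))) (index-enum i)
      π : Permutation N N
      π = permutation (index ∘ f ∘ enum) (index ∘ g ∘ enum)
        (conj-inverse f g f-cong fg) (conj-inverse g f g-cong gf)

-- Finite fields and Fermat's identity

module FieldProperties (F : Field c ℓ) where
  open Field F hiding (zero)
  open Exp commutativeSemiring
  open SetoidReasoning setoid

  *-cancelˡ-nonzero : ∀ {x y z} → ¬ x ≈ 0# → x * y ≈ x * z → y ≈ z
  *-cancelˡ-nonzero {x} {y} {z} x≉0 xy≈xz = trans (sym (undo y)) (trans (*-congˡ xy≈xz) (undo z))
    where
    x⁻¹ = proj₁ (inverse x x≉0)
    undo : ∀ y → x⁻¹ * (x * y) ≈ y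
    undo y = begin
      x⁻¹ * (x * y)  ≈⟨ *-assoc _ _ _ ⟨
      x⁻¹ * x * y    ≈⟨ *-congʳ (trans (*-comm _ _) (proj₂ (inverse x x≉0))) ⟩
      1# * y         ≈⟨ *-identityˡ y ⟩
      y              ∎

  x*y≈0⇒y≈0 : ∀ {x y} → ¬ x ≈ 0# → x * y ≈ 0# → y ≈ 0#
  x*y≈0⇒y≈0 x≉0 xy≈0 = *-cancelˡ-nonzero x≉0 (trans xy≈0 (sym (zeroʳ _)))

  *-nonzero : ∀ {x y} → ¬ x ≈ 0# → ¬ y ≈ 0# → ¬ x * y ≈ 0#
  *-nonzero x≉0 y≉0 xy≈0 = y≉0 (x*y≈0⇒y≈0 x≉0 xy≈0)

  ^-nonzero : ∀ {x} n → ¬ x ≈ 0# → ¬ x ^ n ≈ 0#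
  ^-nonzero zero    x≉0 = 1≉0
  ^-nonzero (suc n) x≉0 = *-nonzero x≉0 (^-nonzero n x≉0)

module FiniteField (F : Field c ℓ) {N : ℕ} (order : HasOrder F N) where
  open Field F hiding (zero)
  open FieldProperties F public
  open FiniteSetoid setoid order public
  open Exp commutativeSemiring
  open Mult semiring using () renaming (_×_ to _·_)
  open GroupProperties +-group using () renaming (∙-cancelˡ to +-cancelˡ)
  open SetoidReasoning setoid
  private
    module Σ = MonoidSum +-commutativeMonoid
    module Π = MonoidSum *-commutativeMonoid

  ^≈0⇒≈0 : ∀ {x} n → x ^ n ≈ 0# → x ≈ 0#
  ^≈0⇒≈0 {x} n xⁿ≈0 with x ≟ 0#
  ... | yes x≈0 = x≈0
  ... | no  x≉0 = contradiction xⁿ≈0 (^-nonzero n x≉0)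

  -- Translation by `1#` permutes the field, so it leaves the sum of all elements unchanged while
  -- adding `N · 1#` to it.
  order·1≈0 : N · 1# ≈ 0#
  order·1≈0 = +-cancelˡ (Σ.sum enum) _ _ (begin
    Σ.sum enum + N · 1#                  ≈⟨ +-congˡ (Σ.sum-replicate N) ⟨
    Σ.sum enum + Σ.sum {N} (λ _ → 1#)    ≈⟨ Σ.∑-distrib-+ enum (λ _ → 1#) ⟨
    Σ.sum (λ i → enum i + 1#)            ≈⟨ sum-enum-permute +-commutativeMonoid (λ x → x) (λ e → e)
                                              (_+ 1#) (_+ - 1#) +-congʳ +-congʳ
                                              (shift (-‿inverseˡ 1#)) (shift (-‿inverseʳ 1#)) ⟨
    Σ.sum enum                           ≈⟨ +-identityʳ _ ⟨
    Σ.sum enum + 0#                      ∎)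
    where
    shift : ∀ {u v} → u + v ≈ 0# → ∀ x → x + u + v ≈ x
    shift u+v≈0 x = trans (+-assoc x _ _) (trans (+-congˡ u+v≈0) (+-identityʳ x))

  private
    Π-nonzero : ∀ {n} (t : Vector Carrier n) → (∀ i → ¬ t i ≈ 0#) → ¬ Π.sum t ≈ 0#
    Π-nonzero {zero}  t t≉0 = 1≉0
    Π-nonzero {suc n} t t≉0 = *-nonzero (t≉0 zero) (Π-nonzero (t ∘ suc) (t≉0 ∘ suc))

    ifZero : Carrier → Carrier → Carrier → Carrier
    ifZero x u v with x ≟ 0#
    ... | yes _ = u
    ... | no  _ = v

    ifZero-yes : ∀ {x} u v → x ≈ 0# → ifZero x u v ≈ u
    ifZero-yes {x} u v x≈0 with x ≟ 0#
    ... | yes _   = refl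
    ... | no  x≉0 = contradiction x≈0 x≉0

    ifZero-no : ∀ {x} u v → ¬ x ≈ 0# → ifZero x u v ≈ v
    ifZero-no {x} u v x≉0 with x ≟ 0#
    ... | yes x≈0 = contradiction x≈0 x≉0
    ... | no  _   = refl

    -- Replacing 0 by 1 makes the product over the whole enumeration nonzero, which avoids a
    -- separate enumeration of the nonzero elements.
    unit : Carrier → Carrier
    unit x = ifZero x 1# x

    unit-cong : ∀ {x y} → x ≈ y → unit x ≈ unit y
    unit-cong {x} {y} x≈y with x ≟ 0#
    ... | yes x≈0 = sym (ifZero-yes 1# y (trans (sym x≈y) x≈0))
    ... | no  x≉0 = trans x≈y (sym (ifZero-no 1# y (x≉0 ∘ trans x≈y)))

    unit-nonzero : ∀ x → ¬ unit x ≈ 0#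
    unit-nonzero x with x ≟ 0#
    ... | yes x≈0 = 1≉0
    ... | no  x≉0 = x≉0

    -- Multiplication by x permutes the nonzero elements; the factor x contributed by the
    -- element 0 is what makes the exponent N instead of N - 1.
    fermat-nonzero : ∀ x → ¬ x ≈ 0# → x ^ N ≈ x
    fermat-nonzero x x≉0 = *-cancelˡ-nonzero (Π-nonzero (unit ∘ enum) (unit-nonzero ∘ enum)) (begin
      P * x ^ N                                            ≈⟨ *-comm P _ ⟩
      x ^ N * P                                            ≈⟨ *-congʳ (Π.sum-replicate N) ⟨
      Π.sum {N} (λ _ → x) * P                              ≈⟨ Π.∑-distrib-+ (λ _ → x) (unit ∘ enum) ⟨
      Π.sum (λ i → x * unit (enum i))                      ≈⟨ Π.sum-cong-≋ (λ i → scale (enum i)) ⟩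
      Π.sum (λ i → unit (x * enum i) * ifZero (enum i) x 1#) ≈⟨ Π.∑-distrib-+ (unit ∘ (x *_) ∘ enum) _ ⟩
      Π.sum (unit ∘ (x *_) ∘ enum) * Π.sum (λ i → ifZero (enum i) x 1#)
        ≈⟨ *-cong (sym permuted) only-zero ⟩
      P * x                                                ∎)
      where
      P = Π.sum (unit ∘ enum)
      x⁻¹ = proj₁ (inverse x x≉0)
      xx⁻¹≈1 = proj₂ (inverse x x≉0)
      undo : ∀ {u v} → u * v ≈ 1# → ∀ y → u * (v * y) ≈ y
      undo uv≈1 y = trans (sym (*-assoc _ _ y)) (trans (*-congʳ uv≈1) (*-identityˡ y))
      permuted : P ≈ Π.sum (unit ∘ (x *_) ∘ enum)
      permuted = sum-enum-permute *-commutativeMonoid unit unit-cong (x *_) (x⁻¹ *_) *-congˡ *-congˡ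
        (undo xx⁻¹≈1) (undo (trans (*-comm _ _) xx⁻¹≈1))
      only-zero : Π.sum (λ i → ifZero (enum i) x 1#) ≈ x
      only-zero = trans
        (sum-single *-commutativeMonoid (index 0#) _ λ j j≢ → ifZero-no x 1# λ e →
          j≢ (≡.trans (≡.sym (index-enum j)) (cong e)))
        (ifZero-yes x 1# (enum-index 0#))
      scale : ∀ y → x * unit y ≈ unit (x * y) * ifZero y x 1#
      scale y with y ≟ 0#
      ... | yes y≈0 = trans (*-comm x 1#) (*-congʳ (sym (ifZero-yes 1# _ (trans (*-congˡ y≈0) (zeroʳ x)))))
      ... | no  y≉0 = trans (sym (*-identityʳ _)) (*-congʳ (sym (ifZero-no 1# _ (*-nonzero x≉0 y≉0))))

  x^order≈x : ∀ x → x ^ N ≈ x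
  x^order≈x x with x ≟ 0#
  ... | no  x≉0 = fermat-nonzero x x≉0
  ... | yes x≈0 = begin
    x ^ N   ≈⟨ ^-congˡ N x≈0 ⟩
    0# ^ N  ≈⟨ 0^-Fin (index 0#) ⟩
    0#      ≈⟨ x≈0 ⟨
    x       ∎
    where
    -- `0# ^ 0` is `1#`; the index of `0#` in `Fin N` is the evidence that the exponent is positive.
    0^-Fin : ∀ {n} → Fin n → 0# ^ n ≈ 0#
    0^-Fin {suc n} _ = zeroˡ (0# ^ n)

-- Roots of monic polynomials

module MonicPolynomial (F : Field c ℓ) where
  open Field F hiding (zero)
  open FieldProperties F
  open Exp commutativeSemiring
  open CommutativeSemigroupProperties *-commutativeSemigroup using (x∙yz≈y∙xz)
  open GroupProperties +-group using (x∙y⁻¹≈ε⇒x≈y)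
  open SetoidReasoning setoid

  -- The polynomial with leading coefficient 1 and the given lower coefficients, constant term first.
  eval : ∀ {n} → Vec Carrier n → Carrier → Carrier
  eval []      x = 1#
  eval (b ∷ᵛ p) x = x * eval p x + b

  eval-replicate-0 : ∀ n x → eval (replicate n 0#) x ≈ x ^ n
  eval-replicate-0 zero    x = refl
  eval-replicate-0 (suc n) x = trans (+-identityʳ _) (*-congˡ (eval-replicate-0 n x))

  -- Horner's scheme: the coefficients of the quotient by `x - a` are the values at `a` of the
  -- successive tails.
  divide : ∀ {n} → Vec Carrier (suc n) → Carrier → Vec Carrier n
  divide {zero}  (b ∷ᵛ [])  a = []
  divide {suc n} (b ∷ᵛ p)   a = eval p a ∷ᵛ divide p a

  private
    x≈x-a+a : ∀ x a → x ≈ x - a + a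
    x≈x-a+a x a = sym (trans (+-assoc x _ _) (trans (+-congˡ (-‿inverseˡ a)) (+-identityʳ x)))

    split : ∀ x a y b → x * y + b ≈ (x - a) * y + (a * y + b)
    split x a y b = begin
      x * y + b                    ≈⟨ +-congʳ (*-congʳ (x≈x-a+a x a)) ⟩
      (x - a + a) * y + b          ≈⟨ +-congʳ (distribʳ y _ _) ⟩
      (x - a) * y + a * y + b      ≈⟨ +-assoc _ _ _ ⟩
      (x - a) * y + (a * y + b)    ∎

  eval-divide : ∀ {n} (p : Vec Carrier (suc n)) a x → eval p x ≈ (x - a) * eval (divide p a) x + eval p a
  eval-divide {zero}  (b ∷ᵛ []) a x = split x a 1# b
  eval-divide {suc n} (b ∷ᵛ p)  a x = begin
    x * eval p x + b                                ≈⟨ +-congʳ (*-congˡ (eval-divide p a x)) ⟩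
    x * ((x - a) * q + pa) + b                      ≈⟨ +-congʳ (distribˡ x _ _) ⟩
    x * ((x - a) * q) + x * pa + b                  ≈⟨ +-assoc _ _ _ ⟩
    x * ((x - a) * q) + (x * pa + b)                ≈⟨ +-cong (x∙yz≈y∙xz x (x - a) q) (split x a pa b) ⟩
    (x - a) * (x * q) + ((x - a) * pa + (a * pa + b)) ≈⟨ +-assoc _ _ _ ⟨
    (x - a) * (x * q) + (x - a) * pa + (a * pa + b) ≈⟨ +-congʳ (distribˡ (x - a) _ _) ⟨
    (x - a) * (x * q + pa) + (a * pa + b)           ∎
    where
    q  = eval (divide p a) x
    pa = eval p a

  -- After `x - z zero` is divided out, the other roots, being different from `z zero`, are roots of
  -- the quotient. The quotient is again monic, so the descent ends at the constant `1#`, which has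
  -- no root.
  roots≤degree : ∀ {m n} (p : Vec Carrier n) (z : Vector Carrier m) →
    (∀ {i j} → z i ≈ z j → i ≡ j) → (∀ i → eval p (z i) ≈ 0#) → m ℕ.≤ n
  roots≤degree {zero}          p  z inj root = z≤n
  roots≤degree {suc m} {zero}  [] z inj root = contradiction (root zero) 1≉0
  roots≤degree {suc m} {suc n} p  z inj root =
    s≤s (roots≤degree (divide p z₀) (z ∘ suc) (Fin.suc-injective ∘ inj) λ i →
      x*y≈0⇒y≈0 (λ e → Fin.0≢1+n (≡.sym (inj (x∙y⁻¹≈ε⇒x≈y (z (suc i)) z₀ e)))) (begin
        (z (suc i) - z₀) * eval (divide p z₀) (z (suc i))            ≈⟨ +-identityʳ _ ⟨
        (z (suc i) - z₀) * eval (divide p z₀) (z (suc i)) + 0#       ≈⟨ +-congˡ (root zero) ⟨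
        (z (suc i) - z₀) * eval (divide p z₀) (z (suc i)) + eval p z₀ ≈⟨ eval-divide p z₀ (z (suc i)) ⟨
        eval p (z (suc i))                                           ≈⟨ root (suc i) ⟩
        0#                                                           ∎))
    where z₀ = z zero

-- Subfields as fixed sets of a power map

module SubfieldProperties (F : Field c ℓ) (E : Subfield F p) where
  open Field F hiding (zero)
  open Subfield E
  open Exp commutativeSemiring
  private module 𝔼 = Exp (Field.commutativeSemiring asField)

  proj₁-^ : ∀ s n → proj₁ (s 𝔼.^ n) ≡ proj₁ s ^ n
  proj₁-^ s zero    = ≡.refl
  proj₁-^ s (suc n) = ≡.cong (proj₁ s *_) (proj₁-^ s n)

  ^-closed : ∀ {x} n → x ∈ Member → x ^ n ∈ Member
  ^-closed zero    x∈ = 1∈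
  ^-closed (suc n) x∈ = *-closed x∈ (^-closed n x∈)

  module _ {N Q : ℕ} (order : HasOrder F N) (orderᴱ : HasOrder asField Q) where
    private module 𝔽 = FiniteField F order
    private module 𝔼ᶠ = FiniteField asField orderᴱ
    open MonicPolynomial F
    open SetoidReasoning setoid

    member⇒fixed : ∀ {x} → x ∈ Member → x ^ Q ≈ x
    member⇒fixed {x} x∈ = trans (reflexive (≡.sym (proj₁-^ (x , x∈) Q))) (𝔼ᶠ.x^order≈x (x , x∈))

    -- A fixed `x` outside `E` would join the `Q` elements of `E` as one root too many of `x^Q - x`.
    -- With `1 < Q` the coefficient of `x` is distinct from the leading one, so that this polynomial
    -- has the monic form `xQ-x`.
    fixed⇒member : 1 ℕ.< Q → ∀ {x} → x ^ Q ≈ x → x ∈ Member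
    fixed⇒member (s≤s (s≤s {n = Q-2} z≤n)) {x} xQ≈x
      with Fin.any? (λ i → proj₁ (𝔼ᶠ.enum i) 𝔽.≟ x)
    ... | yes (i , e) = resp e (proj₂ (𝔼ᶠ.enum i))
    ... | no  ¬e      = contradiction (roots≤degree xQ-x roots inj root) ℕ.1+n≰n
      where
      xQ-x = 0# ∷ᵛ - 1# ∷ᵛ replicate Q-2 0#
      roots : Vector Carrier (suc (suc (suc Q-2)))
      roots = x ∷ (proj₁ ∘ 𝔼ᶠ.enum)
      inj : ∀ {i j} → roots i ≈ roots j → i ≡ j
      inj {zero}  {zero}  e = ≡.refl
      inj {zero}  {suc j} e = contradiction (j , sym e) ¬e
      inj {suc i} {zero}  e = contradiction (i , e) ¬e
      inj {suc i} {suc j} e = ≡.cong suc (𝔼ᶠ.enum-injective e)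
      fixed-root : ∀ y → y ^ suc (suc Q-2) ≈ y → eval xQ-x y ≈ 0#
      fixed-root y yQ≈y = begin
        y * (y * eval (replicate Q-2 0#) y + - 1#) + 0#  ≈⟨ +-identityʳ _ ⟩
        y * (y * eval (replicate Q-2 0#) y + - 1#)       ≈⟨ *-congˡ (+-congʳ (*-congˡ (eval-replicate-0 Q-2 y))) ⟩
        y * (y ^ suc Q-2 + - 1#)                         ≈⟨ distribˡ y _ _ ⟩
        y ^ suc (suc Q-2) + y * - 1#                     ≈⟨ +-cong yQ≈y (trans (*-comm y _) (RingProperties.-1*x≈-x ring y)) ⟩
        y + - y                                          ≈⟨ -‿inverseʳ y ⟩
        0#                                               ∎
      root : ∀ i → eval xQ-x (roots i) ≈ 0#
      root zero    = fixed-root x xQ≈x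
      root (suc i) = fixed-root _ (member⇒fixed (proj₂ (𝔼ᶠ.enum i)))

-- Characteristic and additivity of the Frobenius map

module Characteristic (F : Field c ℓ) where
  open Field F hiding (zero)
  open Exp commutativeSemiring
  open Mult semiring renaming (_×_ to _·_)
  open SetoidReasoning setoid

  AdditivePower : ℕ → Set _
  AdditivePower e = ∀ x y → (x + y) ^ e ≈ x ^ e + y ^ e

  additivePower-^ : ∀ {e} → AdditivePower e → ∀ k → AdditivePower (e ℕ.^ k)
  additivePower-^ {e} add zero x y = trans (*-identityʳ _) (sym (+-cong (*-identityʳ x) (*-identityʳ y)))
  additivePower-^ {e} add (suc k) x y = begin
    (x + y) ^ (e ℕ.* e ℕ.^ k)                     ≈⟨ ^-assocʳ (x + y) e _ ⟨
    ((x + y) ^ e) ^ (e ℕ.^ k)                     ≈⟨ ^-congˡ (e ℕ.^ k) (add x y) ⟩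
    (x ^ e + y ^ e) ^ (e ℕ.^ k)                   ≈⟨ additivePower-^ add k (x ^ e) (y ^ e) ⟩
    (x ^ e) ^ (e ℕ.^ k) + (y ^ e) ^ (e ℕ.^ k)     ≈⟨ +-cong (^-assocʳ x e _) (^-assocʳ y e _) ⟩
    x ^ (e ℕ.* e ℕ.^ k) + y ^ (e ℕ.* e ℕ.^ k)     ∎

  ^-·1 : ∀ m k → (m ℕ.^ k) · 1# ≈ (m · 1#) ^ k
  ^-·1 m zero    = +-identityʳ 1#
  ^-·1 m (suc k) = trans (×1-homo-* m (m ℕ.^ k)) (*-congˡ (^-·1 m k))

  divides-·≈0 : ∀ {r m} → r · 1# ≈ 0# → r ∣ m → ∀ x → m · x ≈ 0#
  divides-·≈0 {r} r·1≈0 (divides k ≡.refl) x = begin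
    (k ℕ.* r) · x         ≈⟨ ×-congʳ (k ℕ.* r) (*-identityˡ x) ⟨
    (k ℕ.* r) · (1# * x)  ≈⟨ ×-assoc-* (k ℕ.* r) 1# x ⟨
    (k ℕ.* r) · 1# * x    ≈⟨ *-congʳ (×1-homo-* k r) ⟩
    k · 1# * r · 1# * x   ≈⟨ *-congʳ (trans (*-congˡ r·1≈0) (zeroʳ _)) ⟩
    0# * x                ≈⟨ zeroˡ x ⟩
    0#                    ∎

  frobenius-+ : ∀ {r} → Prime r → r · 1# ≈ 0# → AdditivePower r
  frobenius-+ {zero}    pr _     x y = contradiction pr ¬prime[0]
  frobenius-+ {suc r-1} pr r·1≈0 x y = begin
    (x + y) ^ r                                                    ≈⟨ Binomial.theorem commutativeSemiring r x y ⟩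
    binomialTerm zero + sum (binomialTerm ∘ suc)                   ≈⟨ +-cong first (trans others last) ⟩
    y ^ r + x ^ r                                                  ≈⟨ +-comm _ _ ⟩
    x ^ r + y ^ r                                                  ∎
    where
    r = suc r-1
    open MonoidSum +-commutativeMonoid using (sum)
    binomialTerm : Vector Carrier (suc r)
    binomialTerm = Binomial.binomialTerm commutativeSemiring x y r
    first : binomialTerm zero ≈ y ^ r
    first = trans (×-homo-1 _) (*-identityˡ _)
    -- Entry `j` of the tail is the term with `x`-exponent `suc j`, so `fromℕ r-1` is the outer term
    -- `x ^ r`, and every other `suc j` lies strictly between 0 and `r`.
    others : sum (binomialTerm ∘ suc) ≈ binomialTerm (suc (fromℕ r-1))
    others = sum-single +-commutativeMonoid (fromℕ r-1) (binomialTerm ∘ suc) λ j j≢ →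
      divides-·≈0 r·1≈0 (prime∣C pr (s≤s z≤n) (s≤s (ℕ.≤∧≢⇒< (Fin.toℕ≤pred[n] j) λ e →
        j≢ (Fin.toℕ-injective (≡.trans e (≡.sym (Fin.toℕ-fromℕ r-1))))))) _
    last : binomialTerm (suc (fromℕ r-1)) ≈ x ^ r
    last rewrite Fin.toℕ-fromℕ r-1 | nCn≡1 r | ℕ.n∸n≡0 r-1 = trans (×-homo-1 _) (*-identityʳ _)

  -- The order is a power of `r`, so `order·1≈0` says that a power of `r · 1#` vanishes. A field has
  -- no nilpotent elements, hence `r · 1#` itself is zero.
  q-power-additive : ∀ {q m} → IsPrimePower q → HasOrder F (q ℕ.^ m) → AdditivePower q
  q-power-additive {m = m} (r , k , pr , _ , ≡.refl) order = additivePower-^ (frobenius-+ pr r·1≈0) k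
    where
    open FiniteField F order
    r·1≈0 : r · 1# ≈ 0#
    r·1≈0 = ^≈0⇒≈0 k (trans (sym (^-·1 r k))
      (^≈0⇒≈0 m (trans (sym (^-·1 (r ℕ.^ k) m)) order·1≈0)))

-- Linear combinations, rank and nullity

module LinearCombination (k : Field c ℓ) (V : VectorSpace k m ℓm) where
  open Field k hiding (zero)
  open LeftModule V
  open LeftModuleProperties V
  open MonoidSum +ᴹ-commutativeMonoid using (sum-cong-≋; ∑-distrib-+)
  open MonoidSum +-commutativeMonoid using (sum)
  open SetoidReasoning ≈ᴹ-setoid

  lc : ∀ {r} → Vector Carrier r → Vector Carrierᴹ r → Carrierᴹ
  lc = linearCombination k V

  lc-cong : ∀ {r} {s t : Vector Carrier r} {u v : Vector Carrierᴹ r} →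
    (∀ i → s i ≈ t i) → (∀ i → u i ≈ᴹ v i) → lc s u ≈ᴹ lc t v
  lc-cong s≈t u≈v = sum-cong-≋ λ i → *ₗ-cong (s≈t i) (u≈v i)

  lc-zero : ∀ {r} (v : Vector Carrierᴹ r) → lc (λ _ → 0#) v ≈ᴹ 0ᴹ
  lc-zero v = sum-zero +ᴹ-commutativeMonoid _ (λ i → *ₗ-zeroˡ (v i))

  lc-+ : ∀ {r} (s t : Vector Carrier r) v → lc (λ i → s i + t i) v ≈ᴹ lc s v +ᴹ lc t v
  lc-+ s t v = ≈ᴹ-trans (sum-cong-≋ λ i → *ₗ-distribʳ (v i) (s i) (t i))
    (∑-distrib-+ (λ i → s i *ₗ v i) (λ i → t i *ₗ v i))

  lc-*ₗ : ∀ {r} a (s : Vector Carrier r) v → lc (λ i → a * s i) v ≈ᴹ a *ₗ lc s v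
  lc-*ₗ {zero}  a s v = ≈ᴹ-sym (*ₗ-zeroʳ a)
  lc-*ₗ {suc r} a s v = begin
    (a * s zero) *ₗ v zero +ᴹ lc (λ i → a * s (suc i)) (v ∘ suc)
      ≈⟨ +ᴹ-cong (*ₗ-assoc a _ _) (lc-*ₗ a (s ∘ suc) (v ∘ suc)) ⟩
    a *ₗ s zero *ₗ v zero +ᴹ a *ₗ lc (s ∘ suc) (v ∘ suc)
      ≈⟨ *ₗ-distribˡ a _ _ ⟨
    a *ₗ lc s v ∎

  lc-unit : ∀ {r} (v : Vector Carrierᴹ r) (i : Fin r) → v i ∈ Span k V v
  lc-unit {r} v i = δ , (begin
    v i         ≈⟨ *ₗ-identityˡ (v i) ⟨
    1# *ₗ v i   ≈⟨ *ₗ-congʳ δ-diagonal ⟨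
    δ i *ₗ v i  ≈⟨ sum-single +ᴹ-commutativeMonoid i (λ j → δ j *ₗ v j) (λ j j≢i →
                     ≈ᴹ-trans (*ₗ-congʳ (δ-off j j≢i)) (*ₗ-zeroˡ (v j))) ⟨
    lc δ v      ∎)
    where
    δ : Vector Carrier r
    δ j with j Fin.≟ i
    ... | yes _ = 1#
    ... | no  _ = 0#
    δ-diagonal : δ i ≈ 1#
    δ-diagonal with i Fin.≟ i
    ... | yes _ = refl
    ... | no ¬e = contradiction ≡.refl ¬e
    δ-off : ∀ j → j ≢ i → δ j ≈ 0#
    δ-off j j≢i with j Fin.≟ i
    ... | yes e = contradiction e j≢i
    ... | no  _ = refl

  lc-lc : ∀ {r n} (t : Vector Carrier r) (s : Vector (Vector Carrier n) r) (v : Vector Carrierᴹ n) →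
    lc t (λ l → lc (s l) v) ≈ᴹ lc (λ i → sum (λ l → t l * s l i)) v
  lc-lc {zero}  t s v = ≈ᴹ-sym (lc-zero v)
  lc-lc {suc r} t s v = begin
    t zero *ₗ lc (s zero) v +ᴹ lc (t ∘ suc) (λ l → lc (s (suc l)) v)
      ≈⟨ +ᴹ-cong (≈ᴹ-sym (lc-*ₗ (t zero) (s zero) v)) (lc-lc (t ∘ suc) (s ∘ suc) v) ⟩
    lc (λ i → t zero * s zero i) v +ᴹ lc (λ i → sum (λ l → t (suc l) * s (suc l) i)) v
      ≈⟨ lc-+ _ _ v ⟨
    lc (λ i → sum (λ l → t l * s l i)) v ∎

  span-lc : ∀ {r n} (t : Vector Carrier r) {u : Vector Carrierᴹ r} {v : Vector Carrierᴹ n} →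
    (∀ l → u l ∈ Span k V v) → lc t u ∈ Span k V v
  span-lc t u∈ = _ , ≈ᴹ-trans (lc-cong (λ _ → refl) (proj₂ ∘ u∈)) (lc-lc t (proj₁ ∘ u∈) _)

  span-resp : ∀ {n x y} {v : Vector Carrierᴹ n} → x ≈ᴹ y → y ∈ Span k V v → x ∈ Span k V v
  span-resp x≈y (s , y≈) = s , ≈ᴹ-trans x≈y y≈

  span-*ₗ : ∀ {n x} a {v : Vector Carrierᴹ n} → x ∈ Span k V v → a *ₗ x ∈ Span k V v
  span-*ₗ a (s , x≈) = _ , ≈ᴹ-trans (*ₗ-congˡ x≈) (≈ᴹ-sym (lc-*ₗ a s _))

  x-1x≈0 : ∀ x → x +ᴹ (- 1#) *ₗ x ≈ᴹ 0ᴹ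
  x-1x≈0 x = begin
    x +ᴹ (- 1#) *ₗ x         ≈⟨ +ᴹ-congʳ (*ₗ-identityˡ x) ⟨
    1# *ₗ x +ᴹ (- 1#) *ₗ x   ≈⟨ *ₗ-distribʳ x 1# (- 1#) ⟨
    (1# + - 1#) *ₗ x         ≈⟨ *ₗ-congʳ (-‿inverseʳ 1#) ⟩
    0# *ₗ x                  ≈⟨ *ₗ-zeroˡ x ⟩
    0ᴹ                       ∎

  -1*ₗ : ∀ x → (- 1#) *ₗ x ≈ᴹ -ᴹ x
  -1*ₗ x = inverseʳ-uniqueᴹ x _ (x-1x≈0 x)

  -- Rank and nullity in terms of witnesses: the pivots are a basis of the span of `v`, the
  -- relations are independent in the kernel of `s ↦ lc s v`, and the two counts add up to `n`.
  -- Lower bounds on the kernel thus come without a theory of dimension.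
  record RankNullity {n : ℕ} (v : Vector Carrierᴹ n) : Set (c ⊔ ℓ ⊔ m ⊔ ℓm) where
    field
      rank nullity          : ℕ
      rank+nullity          : rank ℕ.+ nullity ≡ n
      pivot                 : Fin rank → Fin n
      independent           : LinearlyIndependent k V (v ∘ pivot)
      spanning              : ∀ i → v i ∈ Span k V (v ∘ pivot)
      relation              : Vector (Vector Carrier n) nullity
      relation≈0            : ∀ l → lc (relation l) v ≈ᴹ 0ᴹ
      relation-independent  : ∀ (t : Vector Carrier nullity) →
        (∀ i → sum (λ l → t l * relation l i) ≈ 0#) → ∀ l → t l ≈ 0#

module FiniteLinearAlgebra (k : Field c ℓ) {Q : ℕ} (order : HasOrder k Q) (V : VectorSpace k m ℓm)
    (_≟ᴹ_ : Decidable (LeftModule._≈ᴹ_ V)) where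
  open Field k hiding (zero)
  open LeftModule V
  open LeftModuleProperties V
  open LinearCombination k V
  open FiniteField k order hiding (_≟_)
  private module 𝔽 = FiniteField k order

  -- There are only `Q ^ n` coefficient vectors; `finToFun` enumerates them and all are tried.
  span? : ∀ {n} (v : Vector Carrierᴹ n) x → Dec (x ∈ Span k V v)
  span? {n} v x = map′ (λ (i , e) → _ , e) encode (Fin.any? λ i → x ≟ᴹ lc (enum ∘ finToFun i) v)
    where
    encode : x ∈ Span k V v → ∃ λ i → x ≈ᴹ lc (enum ∘ finToFun {Q} {n} i) v
    encode (s , e) = funToFin (index ∘ s) , ≈ᴹ-trans e (lc-cong (λ j → sym
      (trans (reflexive (≡.cong enum (Fin.finToFun-funToFin (index ∘ s) j))) (enum-index (s j)))) (λ _ → ≈ᴹ-refl))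

  independent-∷ : ∀ {r} x (v : Vector Carrierᴹ r) → LinearlyIndependent k V v → ¬ (x ∈ Span k V v) →
    LinearlyIndependent k V (x ∷ v)
  independent-∷ x v ind x∉ s lc≈0 with s zero 𝔽.≟ 0#
  ... | no s₀≉0 = contradiction (span-resp x≈ (span-*ₗ s₀⁻¹ (span-*ₗ (- 1#) (s ∘ suc , ≈ᴹ-refl)))) x∉
    where
    s₀⁻¹ = proj₁ (inverse (s zero) s₀≉0)
    open SetoidReasoning ≈ᴹ-setoid
    x≈ : x ≈ᴹ s₀⁻¹ *ₗ (- 1#) *ₗ lc (s ∘ suc) v
    x≈ = begin
      x                        ≈⟨ *ₗ-identityˡ x ⟨
      1# *ₗ x                  ≈⟨ *ₗ-congʳ (trans (*-comm _ _) (proj₂ (inverse (s zero) s₀≉0))) ⟨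
      (s₀⁻¹ * s zero) *ₗ x     ≈⟨ *ₗ-assoc _ _ x ⟩
      s₀⁻¹ *ₗ s zero *ₗ x      ≈⟨ *ₗ-congˡ (inverseˡ-uniqueᴹ _ _ lc≈0) ⟩
      s₀⁻¹ *ₗ -ᴹ lc (s ∘ suc) v ≈⟨ *ₗ-congˡ (-1*ₗ _) ⟨
      s₀⁻¹ *ₗ (- 1#) *ₗ lc (s ∘ suc) v ∎
  ... | yes s₀≈0 = λ where
    zero    → s₀≈0
    (suc i) → ind (s ∘ suc) (≈ᴹ-trans (≈ᴹ-sym (+ᴹ-identityˡ _))
                (≈ᴹ-trans (+ᴹ-congʳ (≈ᴹ-sym (≈ᴹ-trans (*ₗ-congʳ s₀≈0) (*ₗ-zeroˡ x)))) lc≈0)) i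

  -- A vector outside the span of the later ones becomes a pivot; otherwise it yields a relation.
  -- That relation has `1#` at the new position, where the older ones have `0#`, so it is
  -- independent of them.
  rankNullity : ∀ {n} (v : Vector Carrierᴹ n) → RankNullity v
  rankNullity {zero} v = record
    { rank = 0 ; nullity = 0 ; rank+nullity = ≡.refl ; pivot = λ () ; independent = λ _ _ ()
    ; spanning = λ () ; relation = λ () ; relation≈0 = λ () ; relation-independent = λ _ _ () }
  rankNullity {suc n} v = extend (span? (v ∘ suc) (v zero))
    where
    open RankNullity (rankNullity (v ∘ suc))
    zero*+ : ∀ x s → s ≈ᴹ 0ᴹ → 0# *ₗ x +ᴹ s ≈ᴹ 0ᴹ
    zero*+ x s s≈0 = ≈ᴹ-trans (+ᴹ-cong (*ₗ-zeroˡ x) s≈0) (+ᴹ-identityˡ 0ᴹ)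
    extend : Dec (v zero ∈ Span k V (v ∘ suc)) → RankNullity v
    extend (yes (s , v₀≈)) = record
      { rank = rank ; nullity = suc nullity
      ; rank+nullity = ≡.trans (ℕ.+-suc rank nullity) (≡.cong suc rank+nullity)
      ; pivot = suc ∘ pivot ; independent = independent
      ; spanning = λ { zero → span-resp v₀≈ (span-lc s spanning) ; (suc i) → spanning i }
      ; relation = (1# ∷ λ i → - 1# * s i) ∷ λ l → 0# ∷ relation l
      ; relation≈0 = λ
        { zero    → ≈ᴹ-trans (+ᴹ-cong (*ₗ-identityˡ _)
                      (≈ᴹ-trans (lc-*ₗ (- 1#) s (v ∘ suc)) (*ₗ-congˡ (≈ᴹ-sym v₀≈)))) (x-1x≈0 (v zero))
        ; (suc l) → zero*+ (v zero) _ (relation≈0 l) }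
      ; relation-independent = λ t e →
          let t₀≈0 : t zero ≈ 0#
              t₀≈0 = trans (sym (trans (+-cong (*-identityʳ (t zero))
                        (sum-zero +-commutativeMonoid (λ l → t (suc l) * 0#) (λ l → zeroʳ (t (suc l)))))
                        (+-identityʳ (t zero)))) (e zero)
          in λ { zero    → t₀≈0
               ; (suc l) → relation-independent (t ∘ suc) (λ i → trans (sym (trans
                             (+-congʳ (trans (*-congʳ t₀≈0) (zeroˡ _))) (+-identityˡ _))) (e (suc i))) l }
      }
    extend (no v₀∉) = record
      { rank = suc rank ; nullity = nullity ; rank+nullity = ≡.cong suc rank+nullity
      ; pivot = zero ∷ (suc ∘ pivot)
      ; independent = λ s e → independent-∷ (v zero) (v ∘ suc ∘ pivot) independent
          (λ (t , v₀≈) → v₀∉ (span-resp v₀≈ (span-lc t (λ i → lc-unit (v ∘ suc) (pivot i))))) s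
          (≈ᴹ-trans (+ᴹ-congˡ ≈ᴹ-refl) e)
      ; spanning = λ { zero → lc-unit (v ∘ (zero ∷ (suc ∘ pivot))) zero
                     ; (suc i) → span-resp {v = v ∘ (zero ∷ (suc ∘ pivot))} (proj₂ (spanning i))
                         (0# ∷ proj₁ (spanning i) ,
                         ≈ᴹ-sym (≈ᴹ-trans (+ᴹ-congʳ (*ₗ-zeroˡ (v zero))) (+ᴹ-identityˡ _))) }
      ; relation = λ l → 0# ∷ relation l
      ; relation≈0 = λ l → zero*+ (v zero) _ (relation≈0 l)
      ; relation-independent = λ t e → relation-independent t (e ∘ suc)
      }

-- Powers of the Frobenius map

module Frobenius (F : Field c ℓ) (q : ℕ) (additive : Characteristic.AdditivePower F q) where
  open Field F hiding (zero)
  open Exp commutativeSemiring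
  open GroupProperties +-group using (identityʳ-unique; inverseʳ-unique)
  open MonoidSum +-commutativeMonoid using (sum)

  φ : ℕ → Carrier → Carrier
  φ m x = x ^ (q ℕ.^ m)

  φ-cong : ∀ m {x y} → x ≈ y → φ m x ≈ φ m y
  φ-cong m = ^-congˡ (q ℕ.^ m)

  φ-≡ : ∀ {m n} x → m ≡ n → φ m x ≈ φ n x
  φ-≡ x ≡.refl = refl

  φ-+ : ∀ m x y → φ m (x + y) ≈ φ m x + φ m y
  φ-+ = Characteristic.additivePower-^ F additive

  φ-* : ∀ m x y → φ m (x * y) ≈ φ m x * φ m y
  φ-* m x y = ^-distrib-* x y (q ℕ.^ m)

  φ-0# : ∀ m → φ m 0# ≈ 0#
  φ-0# m = identityʳ-unique (φ m 0#) _ (trans (sym (φ-+ m 0# 0#)) (φ-cong m (+-identityˡ 0#)))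

  φ-neg : ∀ m x → φ m (- x) ≈ - φ m x
  φ-neg m x = inverseʳ-unique _ _ (trans (sym (φ-+ m x (- x))) (trans (φ-cong m (-‿inverseʳ x)) (φ-0# m)))

  φ-sum : ∀ m {n} (t : Vector Carrier n) → φ m (sum t) ≈ sum (φ m ∘ t)
  φ-sum m {zero}  t = φ-0# m
  φ-sum m {suc n} t = trans (φ-+ m (t zero) _) (+-congˡ (φ-sum m (t ∘ suc)))

  φ-φ : ∀ m n x → φ m (φ n x) ≈ φ (m ℕ.+ n) x
  φ-φ m n x = trans (^-assocʳ x (q ℕ.^ n) (q ℕ.^ m))
    (^-congʳ x (≡.trans (≡.sym (ℕ.^-distribˡ-+-* q n m)) (≡.cong (q ℕ.^_) (ℕ.+-comm n m))))

  φ₀ : ∀ x → φ 0 x ≈ x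
  φ₀ = *-identityʳ

  φ₁ : ∀ x → φ 1 x ≈ x ^ q
  φ₁ x = ^-congʳ x (ℕ.*-identityʳ q)

  φ-fixed : ∀ m {x} → φ m x ≈ x → ∀ k → φ (m ℕ.* k) x ≈ x
  φ-fixed m {x} fix zero    = trans (φ-≡ x (ℕ.*-zeroʳ m)) (φ₀ x)
  φ-fixed m {x} fix (suc k) = trans (φ-≡ x (ℕ.*-suc m k)) (trans (sym (φ-φ m (m ℕ.* k) x))
    (trans (φ-cong m (φ-fixed m fix k)) fix))

-- Linearized polynomials and their zeros

module Linearized (F : Field c ℓ) (E : Subfield F p) (q : ℕ)
    (additive : Characteristic.AdditivePower F q)
    (member⇒fixed : ∀ {x} → x ∈ Subfield.Member E → Field._≈_ F (Frobenius.φ F q additive 2 x) x)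
    (fixed⇒member : ∀ {x} → Field._≈_ F (Frobenius.φ F q additive 2 x) x → x ∈ Subfield.Member E) where
  open Field F hiding (zero)
  open Subfield E
  open Frobenius F q additive
  open FieldProperties F
  open MonoidSum +-commutativeMonoid using (sum; sum-cong-≋)
  open RingProperties ring using (-‿distribˡ-*; -‿distribʳ-*; -‿+-comm)
  open GroupProperties +-group using (x∙y⁻¹≈ε⇒x≈y)
  open LinearCombination asField (overSubfield F E) using (lc)
  open CommutativeSemigroupProperties *-commutativeSemigroup using (x∙yz≈y∙xz; xy∙z≈xz∙y)
  open CommutativeSemigroupProperties +-commutativeSemigroup using ()
    renaming (interchange to +-interchange; x∙yz≈y∙xz to x+yz≈y+xz)
  open SetoidReasoning setoid

  LinInd : ∀ {m} → Vector Carrier m → Set _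
  LinInd = LinearlyIndependent asField (overSubfield F E)

  lin : ∀ {m} → Vector Carrier m → Carrier → Carrier
  lin a x = sum (λ i → a i * φ (2 ℕ.* toℕ i) x)

  lin-cong : ∀ {m} (a : Vector Carrier m) {x y} → x ≈ y → lin a x ≈ lin a y
  lin-cong a x≈y = sum-cong-≋ λ i → *-congˡ {a i} (φ-cong (2 ℕ.* toℕ i) x≈y)

  lin-suc : ∀ {m} (a : Vector Carrier (suc m)) x → lin a x ≈ a zero * x + lin (a ∘ suc) (φ 2 x)
  lin-suc a x = +-cong (*-congˡ (φ₀ x)) (sum-cong-≋ λ i → *-congˡ {a (suc i)}
    (trans (φ-≡ x (≡.trans (ℕ.*-suc 2 (toℕ i)) (ℕ.+-comm 2 (2 ℕ.* toℕ i)))) (sym (φ-φ (2 ℕ.* toℕ i) 2 x))))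

  -- For `b = φ 2 z * z⁻¹` with `z` nonzero, the kernel of this `E`-linear map is the line spanned
  -- by `z`: `φ 2 y ≈ b * y` means that `y * z⁻¹` is fixed by `φ 2`.
  τ : Carrier → Carrier → Carrier
  τ b x = φ 2 x - b * x

  τ-+ : ∀ b x y → τ b (x + y) ≈ τ b x + τ b y
  τ-+ b x y = begin
    φ 2 (x + y) - b * (x + y)                  ≈⟨ +-cong (φ-+ 2 x y) (trans (-‿distribʳ-* b _)
                                                    (trans (*-congˡ (sym (-‿+-comm x y))) (distribˡ b _ _))) ⟩
    φ 2 x + φ 2 y + (b * - x + b * - y)        ≈⟨ +-interchange _ _ _ _ ⟩
    φ 2 x + b * - x + (φ 2 y + b * - y)        ≈⟨ +-cong (+-congˡ (-‿distribʳ-* b x)) (+-congˡ (-‿distribʳ-* b y)) ⟨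
    τ b x + τ b y                              ∎

  τ-* : ∀ b s x → s ∈ Member → τ b (s * x) ≈ s * τ b x
  τ-* b s x s∈ = begin
    φ 2 (s * x) - b * (s * x)    ≈⟨ +-cong (trans (φ-* 2 s x) (*-congʳ (member⇒fixed s∈))) (-‿cong (x∙yz≈y∙xz b s x)) ⟩
    s * φ 2 x - s * (b * x)      ≈⟨ +-congˡ (-‿distribʳ-* s _) ⟩
    s * φ 2 x + s * - (b * x)    ≈⟨ distribˡ s _ _ ⟨
    s * τ b x                    ∎

  τ-0 : ∀ b → τ b 0# ≈ 0#
  τ-0 b = trans (+-cong (φ-0# 2) (-‿cong (zeroʳ b))) (-‿inverseʳ 0#)

  τ-lc : ∀ b {m} s (z : Vector Carrier m) → τ b (lc s z) ≈ lc s (τ b ∘ z)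
  τ-lc b {zero}  s z = τ-0 b
  τ-lc b {suc m} s z = trans (τ-+ b _ _) (+-cong (τ-* b _ _ (proj₂ (s zero))) (τ-lc b (s ∘ suc) (z ∘ suc)))

  τ-φ : ∀ b x → τ (φ 2 b) (φ 2 x) ≈ φ 2 (τ b x)
  τ-φ b x = sym (trans (φ-+ 2 _ _) (+-congˡ (trans (φ-neg 2 _) (-‿cong (φ-* 2 b x)))))

  φ≈τ+ : ∀ b x → φ 2 x ≈ τ b x + b * x
  φ≈τ+ b x = sym (trans (+-assoc _ _ _) (trans (+-congˡ (-‿inverseˡ _)) (+-identityʳ _)))

  -- Right division of linearized polynomials by τ b. In the induction b becomes φ 2 b,
  -- because τ (φ 2 b) ∘ φ 2 = φ 2 ∘ τ b.
  divide : ∀ {m} (a : Vector Carrier (suc m)) b → ∃ λ (a′ : Vector Carrier m) → ∃ λ ρ →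
    (∀ x → lin a x ≈ lin a′ (τ b x) + ρ * x) ×
    ((∀ i → a′ i ≈ 0#) → ρ ≈ 0# → ∀ i → a i ≈ 0#)
  divide {zero} a b = (λ ()) , a zero ,
    (λ x → trans (+-comm _ _) (+-congˡ (*-congˡ (φ₀ x)))) , λ { _ ρ≈0 zero → ρ≈0 }
  divide {suc m} a b with divide (a ∘ suc) (φ 2 b)
  -- Dividing the tail leaves `ρ * φ 2 x`. By `φ≈τ+` this contributes `ρ` as the lowest coefficient
  -- of the quotient and `ρ * b` to the remainder.
  ... | a′ , ρ , eq , zeros = ρ ∷ a′ , a zero + ρ * b , eq′ , zeros′
    where
    zeros′ : (∀ i → (ρ ∷ a′) i ≈ 0#) → a zero + ρ * b ≈ 0# → ∀ i → a i ≈ 0#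
    zeros′ a′≈0 e zero = trans (sym (trans (+-congˡ (trans (*-congʳ (a′≈0 zero)) (zeroˡ b))) (+-identityʳ _))) e
    zeros′ a′≈0 e (suc i) = zeros (a′≈0 ∘ suc) (a′≈0 zero) i
    eq′ : ∀ x → lin a x ≈ lin (ρ ∷ a′) (τ b x) + (a zero + ρ * b) * x
    eq′ x = begin
      lin a x
        ≈⟨ lin-suc a x ⟩
      a zero * x + lin (a ∘ suc) (φ 2 x)
        ≈⟨ +-congˡ (eq (φ 2 x)) ⟩
      a zero * x + (lin a′ (τ (φ 2 b) (φ 2 x)) + ρ * φ 2 x)
        ≈⟨ +-congˡ (+-cong (lin-cong a′ (τ-φ b x)) (trans (*-congˡ (φ≈τ+ b x)) (distribˡ ρ _ _))) ⟩
      a zero * x + (lin a′ (φ 2 (τ b x)) + (ρ * τ b x + ρ * (b * x)))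
        ≈⟨ x+yz≈y+xz _ _ _ ⟩
      lin a′ (φ 2 (τ b x)) + (a zero * x + (ρ * τ b x + ρ * (b * x)))
        ≈⟨ +-congˡ (x+yz≈y+xz _ _ _) ⟩
      lin a′ (φ 2 (τ b x)) + (ρ * τ b x + (a zero * x + ρ * (b * x)))
        ≈⟨ +-assoc _ _ _ ⟨
      lin a′ (φ 2 (τ b x)) + ρ * τ b x + (a zero * x + ρ * (b * x))
        ≈⟨ +-cong (+-comm _ _) (trans (+-congˡ (sym (*-assoc ρ b x))) (sym (distribʳ x _ _))) ⟩
      ρ * τ b x + lin a′ (φ 2 (τ b x)) + (a zero + ρ * b) * x
        ≈⟨ +-congʳ (lin-suc (ρ ∷ a′) (τ b x)) ⟨
      lin (ρ ∷ a′) (τ b x) + (a zero + ρ * b) * x ∎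

  -- The induction concerns the coefficients and not just the induced function; this is why `divide`
  -- also records that `a` vanishes as soon as quotient and remainder do.
  lin≈0⇒coefficients≈0 : ∀ {m m′} → m ℕ.≤ m′ → (a : Vector Carrier m) (z : Vector Carrier m′) →
    LinInd z → (∀ l → lin a (z l) ≈ 0#) → ∀ i → a i ≈ 0#
  lin≈0⇒coefficients≈0 {suc m} {suc m′} (s≤s m≤m′) a z ind roots with inverse (z zero) z₀≉0
    where
    z₀≉0 : ¬ z zero ≈ 0#
    z₀≉0 z₀≈0 = 1≉0 (ind (Field.1# asField ∷ λ _ → Field.0# asField)
      (trans (+-cong (trans (*-congˡ z₀≈0) (zeroʳ 1#)) (sum-zero +-commutativeMonoid {m′} _ (λ l → zeroˡ (z (suc l)))))
        (+-identityʳ 0#)) zero)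
  ... | z₀⁻¹ , z₀z₀⁻¹≈1 with divide a (φ 2 (z zero) * z₀⁻¹)
  ... | a′ , ρ , eq , zeros = zeros (lin≈0⇒coefficients≈0 m≤m′ a′ (τ b ∘ z ∘ suc) ind′ roots′) ρ≈0
    where
    b = φ 2 (z zero) * z₀⁻¹
    cancel : ∀ y → y * z₀⁻¹ * z zero ≈ y
    cancel y = trans (*-assoc y _ _) (trans (*-congˡ (trans (*-comm _ _) z₀z₀⁻¹≈1)) (*-identityʳ y))
    lin-0 : lin a′ 0# ≈ 0#
    lin-0 = sum-zero +-commutativeMonoid _ λ i → trans (*-congˡ (φ-0# (2 ℕ.* toℕ i))) (zeroʳ (a′ i))
    τz₀≈0 : τ b (z zero) ≈ 0#
    τz₀≈0 = trans (+-congˡ (-‿cong (cancel _))) (-‿inverseʳ _)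
    -- At `z zero` the quotient part is evaluated at 0, so only `ρ * z zero` remains.
    ρ≈0 : ρ ≈ 0#
    ρ≈0 = begin
      ρ                                              ≈⟨ *-identityʳ ρ ⟨
      ρ * 1#                                         ≈⟨ *-congˡ z₀z₀⁻¹≈1 ⟨
      ρ * (z zero * z₀⁻¹)                            ≈⟨ *-assoc _ _ _ ⟨
      ρ * z zero * z₀⁻¹                              ≈⟨ *-congʳ (+-identityˡ _) ⟨
      (0# + ρ * z zero) * z₀⁻¹                       ≈⟨ *-congʳ (+-congʳ (trans (lin-cong a′ τz₀≈0) lin-0)) ⟨
      (lin a′ (τ b (z zero)) + ρ * z zero) * z₀⁻¹    ≈⟨ *-congʳ (eq (z zero)) ⟨
      lin a (z zero) * z₀⁻¹                          ≈⟨ *-congʳ (roots zero) ⟩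
      0# * z₀⁻¹                                      ≈⟨ zeroˡ z₀⁻¹ ⟩
      0#                                             ∎
    roots′ : ∀ l → lin a′ (τ b (z (suc l))) ≈ 0#
    roots′ l = trans (sym (trans (+-congˡ (trans (*-congʳ ρ≈0) (zeroˡ _))) (+-identityʳ _)))
      (trans (sym (eq (z (suc l)))) (roots (suc l)))
    -- A relation among the images puts the combination `y` into the kernel of `τ b`, so `y` is a
    -- multiple `u * z zero` with `u` in `E`: a relation among the original vectors.
    ind′ : LinInd (τ b ∘ z ∘ suc)
    ind′ s e = λ l → ind (Field.-_ asField (u , u∈) ∷ s) dependence (suc l)
      where
      y = lc s (z ∘ suc)
      u = y * z₀⁻¹
      φy≈by : φ 2 y ≈ b * y
      φy≈by = x∙y⁻¹≈ε⇒x≈y _ _ (trans (τ-lc b s (z ∘ suc)) e)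
      u∈ : u ∈ Member
      u∈ = fixed⇒member (begin
        φ 2 (y * z₀⁻¹)                            ≈⟨ φ-* 2 y z₀⁻¹ ⟩
        φ 2 y * φ 2 z₀⁻¹                          ≈⟨ *-congʳ (trans φy≈by (*-assoc _ _ _)) ⟩
        φ 2 (z zero) * (z₀⁻¹ * y) * φ 2 z₀⁻¹      ≈⟨ xy∙z≈xz∙y _ _ _ ⟩
        φ 2 (z zero) * φ 2 z₀⁻¹ * (z₀⁻¹ * y)      ≈⟨ *-congʳ (φ-* 2 _ _) ⟨
        φ 2 (z zero * z₀⁻¹) * (z₀⁻¹ * y)          ≈⟨ *-congʳ (trans (φ-cong 2 z₀z₀⁻¹≈1) (member⇒fixed 1∈)) ⟩
        1# * (z₀⁻¹ * y)                           ≈⟨ trans (*-identityˡ _) (*-comm _ _) ⟩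
        y * z₀⁻¹                                  ∎)
      dependence : - u * z zero + y ≈ 0#
      dependence = trans (+-congʳ (trans (sym (-‿distribˡ-* u _)) (-‿cong (cancel y)))) (-‿inverseˡ y)

-- Arithmetic of `q`, `n` and `d`

1<q : ∀ {q} → IsPrimePower q → 1 ℕ.< q
1<q (r , k , pr , 1≤k , ≡.refl) =
  ℕ.<-≤-trans (ℕ.≤-trans (prime⇒1< pr) (ℕ.≤-reflexive (≡.sym (ℕ.^-identityʳ r))))
    (ℕ.^-monoʳ-≤ r {{ℕ.nonTrivial⇒nonZero r {{prime⇒nonTrivial pr}}}} 1≤k)

-- Both numbers being odd, `n ∸ d` is twice `a ∸ b`, so the division by 2 is exact.
odd-gap : ∀ {n d} → Odd n → Odd d → d ℕ.≤ n → n ≡ d ℕ.+ 2 ℕ.* ((n ∸ d) / 2)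
odd-gap {n} {d} (a , ≡.refl) (b , ≡.refl) d≤n = begin
  n                              ≡⟨ ℕ.m+[n∸m]≡n d≤n ⟨
  d ℕ.+ (n ∸ d)                  ≡⟨ ≡.cong (d ℕ.+_) n∸d≡ ⟩
  d ℕ.+ (a ∸ b) ℕ.* 2            ≡⟨ ≡.cong (λ k → d ℕ.+ k ℕ.* 2) (m*n/n≡m (a ∸ b) 2) ⟨
  d ℕ.+ (a ∸ b) ℕ.* 2 / 2 ℕ.* 2  ≡⟨ ≡.cong (λ k → d ℕ.+ k / 2 ℕ.* 2) n∸d≡ ⟨
  d ℕ.+ (n ∸ d) / 2 ℕ.* 2        ≡⟨ ≡.cong (d ℕ.+_) (ℕ.*-comm ((n ∸ d) / 2) 2) ⟩
  d ℕ.+ 2 ℕ.* ((n ∸ d) / 2)      ∎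
  where
  open ≡.≡-Reasoning
  n∸d≡ : n ∸ d ≡ (a ∸ b) ℕ.* 2
  n∸d≡ = ≡.trans (≡.cong₂ _∸_ (ℕ.+-comm (2 ℕ.* a) 1) (ℕ.+-comm (2 ℕ.* b) 1))
    (≡.trans (≡.sym (ℕ.*-distribˡ-∸ 2 a b)) (ℕ.*-comm 2 (a ∸ b)))

-- The forms `H` and their Frobenius exponents

module HermitianForms (q n d : ℕ) (primePower : IsPrimePower q)
    (n-odd : Odd n) (d-odd : Odd d) (1≤d : 1 ℕ.≤ d) (d≤n : d ℕ.≤ n)
    (F : Field c ℓ) (E : Subfield F p₁) (K : Subfield F p₂)
    (order  : HasOrder F (q ℕ.^ (2 ℕ.* n)))
    (orderᴱ : HasOrder (Subfield.asField E) (q ℕ.^ 2))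
    (orderᴷ : HasOrder (Subfield.asField K) (q ℕ.^ n)) where
  open Field F hiding (zero)
  open Exp commutativeSemiring
  open SemiringSum semiring using (sum; sum-cong-≋; sum-permute; ∑-distrib-+; *-distribˡ-sum)
  open GroupProperties +-group using () renaming (∙-cancelʳ to +-cancelʳ)
  open CommutativeSemigroupProperties *-commutativeSemigroup using (x∙yz≈y∙xz; xy∙z≈xz∙y; xy∙z≈y∙xz)
  open CommutativeSemigroupProperties +-commutativeSemigroup using () renaming (interchange to +-interchange)
  open SetoidReasoning setoid
  open Construction F E K q n d using (Tr; H; Params; index; V; 𝔽q²) public
  open FiniteField F order using (^≈0⇒≈0) public
  open Subfield E using (Member)

  additivePower : Characteristic.AdditivePower F q
  additivePower = Characteristic.q-power-additive F {m = 2 ℕ.* n} primePower order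

  open Frobenius F q additivePower public

  E-fixed : ∀ {x} → x ∈ Member → φ 2 x ≈ x
  E-fixed = SubfieldProperties.member⇒fixed F E order orderᴱ

  E-member : ∀ {x} → φ 2 x ≈ x → x ∈ Member
  E-member = SubfieldProperties.fixed⇒member F E order orderᴱ
    (ℕ.<-≤-trans (1<q primePower) (ℕ.m≤m*n q (q ℕ.^ 1) {{ℕ.m^n≢0 q 1 {{ℕ.>-nonZero (ℕ.<⇒≤ (1<q primePower))}}}}))

  K-fixed : ∀ {x} → x ∈ Subfield.Member K → φ n x ≈ x
  K-fixed = SubfieldProperties.member⇒fixed F K order orderᴷ

  φ-2n : ∀ x → φ (2 ℕ.* n) x ≈ x
  φ-2n = FiniteField.x^order≈x F order

  open Linearized F E q additivePower E-fixed E-member public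

  E-fixed-even : ∀ {x} → x ∈ Member → ∀ k → φ (2 ℕ.* k) x ≈ x
  E-fixed-even x∈ = φ-fixed 2 (E-fixed x∈)

  e : ℕ
  e = (n ∸ d) / 2

  n≡d+2e : n ≡ d ℕ.+ 2 ℕ.* e
  n≡d+2e = odd-gap n-odd d-odd d≤n

  e≡opposite+index : ∀ (i : Fin e) → e ≡ toℕ (opposite i) ℕ.+ index i
  e≡opposite+index i = ≡.sym (≡.trans (≡.cong (ℕ._+ index i) (Fin.opposite-prop i)) (ℕ.m∸n+n≡m (Fin.toℕ<n i)))

  n≡opposite+index : ∀ (i : Fin e) → n ≡ d ℕ.+ 2 ℕ.* toℕ (opposite i) ℕ.+ 2 ℕ.* index i
  n≡opposite+index i = ≡.trans n≡d+2e (≡.trans (≡.cong (λ k → d ℕ.+ 2 ℕ.* k) (e≡opposite+index i))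
    (solve 3 (λ d o i → d :+ con 2 :* (o :+ i) := d :+ con 2 :* o :+ con 2 :* i) ≡.refl d (toℕ (opposite i)) (index i)))
    where open +-*-Solver

  -- As `index i` runs from `e` down to 1, the exponents are `d`, `d + 2`, ..., `n - 2`; `opposite`
  -- carries out the reversal.
  n∸2index : ∀ (i : Fin e) → n ∸ 2 ℕ.* index i ≡ d ℕ.+ 2 ℕ.* toℕ (opposite i)
  n∸2index i = ≡.trans (≡.cong (_∸ 2 ℕ.* index i) (n≡opposite+index i)) (ℕ.m+n∸n≡m _ (2 ℕ.* index i))

  n+2index+[n∸2index] : ∀ (i : Fin e) → n ℕ.+ 2 ℕ.* index i ℕ.+ (n ∸ 2 ℕ.* index i) ≡ 2 ℕ.* n
  n+2index+[n∸2index] i = ≡.trans (≡.cong (n ℕ.+ 2 ℕ.* index i ℕ.+_) (n∸2index i))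
    (≡.trans (solve 3 (λ n j k → n :+ j :+ k := n :+ (k :+ j)) ≡.refl n (2 ℕ.* index i) (d ℕ.+ 2 ℕ.* toℕ (opposite i)))
    (≡.trans (≡.cong (n ℕ.+_) (≡.sym (n≡opposite+index i))) (solve 1 (λ n → n :+ n := con 2 :* n) ≡.refl n)))
    where open +-*-Solver

  -- Since `d` is odd, `x ↦ x^(q^(n - 2j + 1))` is a power of `x ↦ x^(q²)` and hence `E`-linear, as
  -- the second summand of `H` requires.
  n∸2index+1-even : ∀ (i : Fin e) → ∃ λ k → n ∸ 2 ℕ.* index i ℕ.+ 1 ≡ 2 ℕ.* k
  n∸2index+1-even i = let (b , d≡) = d-odd in suc b ℕ.+ toℕ (opposite i) ,
    ≡.trans (≡.cong (ℕ._+ 1) (≡.trans (n∸2index i) (≡.cong (ℕ._+ 2 ℕ.* toℕ (opposite i)) d≡)))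
      (solve 2 (λ b o → con 2 :* b :+ con 1 :+ con 2 :* o :+ con 1 := con 2 :* (con 1 :+ b :+ o)) ≡.refl b (toℕ (opposite i)))
    where open +-*-Solver

  -- The trace and its invariance under Frobenius

  Tr-cong : ∀ {x y} → x ≈ y → Tr x ≈ Tr y
  Tr-cong x≈y = sum-cong-≋ {n} λ k → φ-cong (2 ℕ.* toℕ k) x≈y

  Tr-+ : ∀ x y → Tr (x + y) ≈ Tr x + Tr y
  Tr-+ x y = trans (sum-cong-≋ {n} λ k → φ-+ (2 ℕ.* toℕ k) x y)
    (∑-distrib-+ {n} (λ k → φ (2 ℕ.* toℕ k) x) (λ k → φ (2 ℕ.* toℕ k) y))

  Tr-0# : Tr 0# ≈ 0#
  Tr-0# = sum-zero +-commutativeMonoid {n} _ λ k → φ-0# (2 ℕ.* toℕ k)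

  Tr-sum : ∀ {m} (t : Vector Carrier m) → Tr (sum t) ≈ sum (Tr ∘ t)
  Tr-sum {zero}  t = Tr-0#
  Tr-sum {suc m} t = trans (Tr-+ _ _) (+-congˡ (Tr-sum (t ∘ suc)))

  Tr-* : ∀ {s} x → s ∈ Member → Tr (s * x) ≈ s * Tr x
  Tr-* {s} x s∈ = trans
    (sum-cong-≋ {n} λ k → trans (φ-* (2 ℕ.* toℕ k) s x) (*-congʳ (E-fixed-even s∈ (toℕ k))))
    (sym (*-distribˡ-sum {n} s (λ k → φ (2 ℕ.* toℕ k) x)))

  φ-Tr : ∀ m x → φ m (Tr x) ≈ Tr (φ m x)
  φ-Tr m x = trans (φ-sum m {n} _) (sum-cong-≋ {n} λ k →
    trans (φ-φ m (2 ℕ.* toℕ k) x) (trans (φ-≡ x (ℕ.+-comm m _)) (sym (φ-φ (2 ℕ.* toℕ k) m x))))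

  -- `φ 2` shifts the summands of the trace cyclically, because the last one turns into
  -- `φ (2 * n) x ≈ x`.
  Tr-φ₂ : ∀ x → Tr (φ 2 x) ≈ Tr x
  Tr-φ₂ x = +-cancelʳ (φ 0 x) _ _ (begin
    Tr (φ 2 x) + φ 0 x                       ≈⟨ +-congʳ (sum-cong-≋ {n} λ k → trans (φ-φ (2 ℕ.* toℕ k) 2 x)
                                                  (φ-≡ x (≡.trans (ℕ.+-comm _ 2) (≡.sym (ℕ.*-suc 2 (toℕ k)))))) ⟩
    sum {n} (λ k → φ (2 ℕ.* suc (toℕ k)) x) + φ 0 x ≈⟨ sum-telescope +-commutativeMonoid n (λ k → φ (2 ℕ.* k) x) ⟩
    Tr x + φ (2 ℕ.* n) x                     ≈⟨ +-congˡ (trans (φ-2n x) (sym (φ₀ x))) ⟩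
    Tr x + φ 0 x                             ∎)

  Tr-φ-even : ∀ k x → Tr (φ (2 ℕ.* k) x) ≈ Tr x
  Tr-φ-even zero    x = Tr-cong (φ₀ x)
  Tr-φ-even (suc k) x = trans (Tr-cong (trans (φ-≡ x (ℕ.*-suc 2 k)) (sym (φ-φ 2 (2 ℕ.* k) x))))
    (trans (Tr-φ₂ _) (Tr-φ-even k x))

  Tr∈E : ∀ x → Tr x ∈ Member
  Tr∈E x = E-member (trans (φ-Tr 2 x) (Tr-φ₂ x))

  -- This permits `φ 1` to be traded under the trace for whichever odd power cancels the exponent at
  -- hand, such as `φ n` or `φ (n + 2j)`.
  Tr-φ-odd : ∀ k m x → m ≡ 2 ℕ.* k ℕ.+ 1 → Tr (φ m x) ≈ Tr (φ 1 x)
  Tr-φ-odd k m x ≡.refl = trans (Tr-cong (sym (φ-φ (2 ℕ.* k) 1 x))) (Tr-φ-even k _)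

  -- Sesquilinearity and Hermitian symmetry

  T : Carrier → Carrier → Carrier → Carrier
  T a x y = a * x * φ n y

  U W : Fin e → Carrier → Carrier → Carrier → Carrier
  U i a x y = a * x * φ (n ∸ 2 ℕ.* index i) y
  W i a x y = a ^ q * φ (n ∸ 2 ℕ.* index i ℕ.+ 1) x * y ^ q

  -- The argument of the trace in `H`, for any `a` in `F`; membership of `a₀` in `K` enters only as
  -- the hypothesis `φ n a ≈ a`.
  S : Carrier → Vector Carrier e → Carrier → Carrier → Carrier
  S a as x y = T a x y + sum (λ i → U i (as i) x y + W i (as i) x y)

  S-cong : ∀ {a a′ as as′ x x′ y y′} → a ≈ a′ → (∀ i → as i ≈ as′ i) → x ≈ x′ → y ≈ y′ →
    S a as x y ≈ S a′ as′ x′ y′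
  S-cong a≈ as≈ x≈ y≈ = +-cong (*-cong (*-cong a≈ x≈) (φ-cong n y≈)) (sum-cong-≋ λ i →
    +-cong (*-cong (*-cong (as≈ i) x≈) (φ-cong (n ∸ 2 ℕ.* index i) y≈))
      (*-cong (*-cong (^-congˡ q (as≈ i)) (φ-cong (n ∸ 2 ℕ.* index i ℕ.+ 1) x≈)) (^-congˡ q y≈)))

  private
    *+* : ∀ {u u₁ u₂} v w → u ≈ u₁ + u₂ → u * v * w ≈ u₁ * v * w + u₂ * v * w
    *+* v w u≈ = trans (*-congʳ (trans (*-congʳ u≈) (distribʳ v _ _))) (distribʳ w _ _)

    +*+ : ∀ u {v v₁ v₂} w → v ≈ v₁ + v₂ → u * v * w ≈ u * v₁ * w + u * v₂ * w
    +*+ u w v≈ = trans (*-congʳ (trans (*-congˡ v≈) (distribˡ u _ _))) (distribʳ w _ _)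

    sum-+ : ∀ {t} {f g h : Fin e → Carrier} {u v : Carrier} → t ≈ u + v → (∀ i → f i ≈ g i + h i) →
      t + sum f ≈ (u + sum g) + (v + sum h)
    sum-+ {g = g} {h} t≈ f≈ = trans (+-cong t≈ (trans (sum-cong-≋ f≈) (∑-distrib-+ g h))) (+-interchange _ _ _ _)

  S-+ᶿ : ∀ a a′ as as′ x y → S (a + a′) (λ i → as i + as′ i) x y ≈ S a as x y + S a′ as′ x y
  S-+ᶿ a a′ as as′ x y = sum-+ (*+* x _ refl) λ i → trans
    (+-cong (*+* x _ refl) (*+* _ _ (additivePower (as i) (as′ i)))) (+-interchange _ _ _ _)

  S-+ : ∀ a as x x′ y → S a as (x + x′) y ≈ S a as x y + S a as x′ y
  S-+ a as x x′ y = sum-+ (+*+ a _ refl) λ i → trans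
    (+-cong (+*+ _ _ refl) (+*+ _ _ (φ-+ (n ∸ 2 ℕ.* index i ℕ.+ 1) x x′))) (+-interchange _ _ _ _)

  S-* : ∀ a as {s} x y → s ∈ Member → S a as (s * x) y ≈ s * S a as x y
  S-* a as {s} x y s∈ = begin
    S a as (s * x) y
      ≈⟨ +-cong (pull a x _) (sum-cong-≋ λ i → +-cong (pull (as i) x _)
           (trans (*-congʳ (*-congˡ (φ-s* i))) (pull (as i ^ q) _ _))) ⟩
    s * T a x y + sum (λ i → s * U i (as i) x y + s * W i (as i) x y)
      ≈⟨ +-congˡ (sum-cong-≋ {e} λ i → sym (distribˡ s (U i (as i) x y) (W i (as i) x y))) ⟩
    s * T a x y + sum (λ i → s * (U i (as i) x y + W i (as i) x y))
      ≈⟨ +-congˡ (*-distribˡ-sum s (λ i → U i (as i) x y + W i (as i) x y)) ⟨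
    s * T a x y + s * sum (λ i → U i (as i) x y + W i (as i) x y)
      ≈⟨ distribˡ s _ _ ⟨
    s * S a as x y ∎
    where
    pull : ∀ u v w → u * (s * v) * w ≈ s * (u * v * w)
    pull u v w = trans (*-congʳ (x∙yz≈y∙xz u s v)) (*-assoc s _ w)
    φ-s* : ∀ i → φ (n ∸ 2 ℕ.* index i ℕ.+ 1) (s * x) ≈ s * φ (n ∸ 2 ℕ.* index i ℕ.+ 1) x
    φ-s* i = let (k , eq) = n∸2index+1-even i in
      trans (φ-* (n ∸ 2 ℕ.* index i ℕ.+ 1) s x) (*-congʳ (trans (φ-≡ s eq) (E-fixed-even s∈ k)))

  Tr-S : ∀ a as x y → Tr (S a as x y) ≈ Tr (T a x y) + sum (λ i → Tr (U i (as i) x y) + Tr (W i (as i) x y))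
  Tr-S a as x y = trans (Tr-+ _ _) (+-congˡ (trans (Tr-sum (λ i → U i (as i) x y + W i (as i) x y))
    (sum-cong-≋ {e} λ i → Tr-+ (U i (as i) x y) (W i (as i) x y))))

  -- The origin of the second summand of each pair in `H`: it is the conjugate of the first one with
  -- `x` and `y` exchanged.
  φ₁-U : ∀ i a x y → φ 1 (U i a x y) ≈ W i a y x
  φ₁-U i a x y = begin
    φ 1 (a * x * φ k y)           ≈⟨ trans (φ-* 1 _ _) (*-congʳ (φ-* 1 a x)) ⟩
    φ 1 a * φ 1 x * φ 1 (φ k y)   ≈⟨ xy∙z≈xz∙y _ _ _ ⟩
    φ 1 a * φ 1 (φ k y) * φ 1 x   ≈⟨ *-cong (*-cong (φ₁ a) (trans (φ-φ 1 k y) (φ-≡ y (ℕ.+-comm 1 k)))) (φ₁ x) ⟩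
    W i a y x                     ∎
    where k = n ∸ 2 ℕ.* index i

  -- As `n` is odd, `φ n` may replace `φ 1`; it fixes `a`, and on `y` it completes `φ n` to
  -- `φ (2 * n)`, the identity.
  Tr-φ₁-T : ∀ {a} x y → φ n a ≈ a → Tr (φ 1 (T a x y)) ≈ Tr (T a y x)
  Tr-φ₁-T {a} x y φa≈a = trans (sym (Tr-φ-odd (proj₁ n-odd) n _ (proj₂ n-odd))) (Tr-cong (begin
    φ n (a * x * φ n y)          ≈⟨ trans (φ-* n _ _) (*-congʳ (φ-* n a x)) ⟩
    φ n a * φ n x * φ n (φ n y)  ≈⟨ *-cong (*-congʳ φa≈a) (trans (φ-φ n n y) (trans (φ-≡ y n+n≡2n) (φ-2n y))) ⟩
    a * φ n x * y                ≈⟨ xy∙z≈xz∙y _ _ _ ⟩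
    a * y * φ n x                ∎))
    where
    n+n≡2n : n ℕ.+ n ≡ 2 ℕ.* n
    n+n≡2n = ≡.cong (n ℕ.+_) (≡.sym (ℕ.+-identityʳ n))

  Tr-S-hermitian : ∀ {a} as x y → φ n a ≈ a → Tr (S a as y x) ≈ Tr (S a as x y) ^ q
  Tr-S-hermitian {a} as x y φa≈a = sym (begin
    Tr (S a as x y) ^ q       ≈⟨ φ₁ _ ⟨
    φ 1 (Tr (S a as x y))     ≈⟨ φ-cong 1 (Tr-S a as x y) ⟩
    φ 1 (Tr (T a x y) + sum (λ i → Tr (U i (as i) x y) + Tr (W i (as i) x y)))
      ≈⟨ trans (φ-+ 1 _ _) (+-congˡ (φ-sum 1 (λ i → Tr (U i (as i) x y) + Tr (W i (as i) x y)))) ⟩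
    φ 1 (Tr (T a x y)) + sum (λ i → φ 1 (Tr (U i (as i) x y) + Tr (W i (as i) x y)))
      ≈⟨ +-cong (trans (φ-Tr 1 _) (Tr-φ₁-T x y φa≈a)) (sum-cong-≋ λ i → trans (φ-+ 1 _ _) (trans (+-comm _ _)
           (+-cong (W⇒U i) (trans (φ-Tr 1 _) (Tr-cong (φ₁-U i (as i) x y)))))) ⟩
    Tr (T a y x) + sum (λ i → Tr (U i (as i) y x) + Tr (W i (as i) y x))
      ≈⟨ Tr-S a as y x ⟨
    Tr (S a as y x) ∎)
    where
    -- `W` is already `φ 1` of a `U`, so conjugating again gives `φ 2` of it, which the trace
    -- absorbs.
    W⇒U : ∀ i → φ 1 (Tr (W i (as i) x y)) ≈ Tr (U i (as i) y x)
    W⇒U i = trans (φ-Tr 1 _) (trans (Tr-cong (trans (φ-cong 1 (sym (φ₁-U i (as i) y x))) (φ-φ 1 1 _))) (Tr-φ₂ _))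

  -- Under the trace, φ (n + 2j - 1) turns the summand a^q * φ (n - 2j + 1) y * x^q of H y x into
  -- φ (n + 2j) (a * x) * y; this is where the upper coefficients come from.
  coefficients : Carrier → Vector Carrier e → Vector Carrier (e ℕ.+ suc e)
  coefficients a as = (as ∘ opposite) ++ (a ∷ λ i → φ (n ℕ.+ 2 ℕ.* index i) (as i))

  L : Carrier → Vector Carrier e → Carrier → Carrier
  L a as x = lin (coefficients a as) (φ d x)

  -- Position `k` of `coefficients` has Frobenius exponent `d + 2k`. This is `n - 2j` at
  -- `k = e - j`, `n` at `k = e`, and `n + 2j` at `k = e + j`.
  L-expand : ∀ a as x → L a as x ≈ a * φ n x
    + sum (λ i → as i * φ (n ∸ 2 ℕ.* index i) x + φ (n ℕ.+ 2 ℕ.* index i) (as i * x))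
  L-expand a as x = begin
    lin (coefficients a as) (φ d x)
      ≈⟨ sum-↑ +-commutativeMonoid e _ ⟩
    sum (λ i → coefficients a as (i ↑ˡ suc e) * φ (2 ℕ.* toℕ (i ↑ˡ suc e)) (φ d x))
      + (coefficients a as (e ↑ʳ zero) * φ (2 ℕ.* toℕ (e ↑ʳ zero {e})) (φ d x)
        + sum (λ i → coefficients a as (e ↑ʳ suc i) * φ (2 ℕ.* toℕ (e ↑ʳ suc i)) (φ d x)))
      ≈⟨ +-cong low (+-cong middle (sum-cong-≋ high)) ⟩
    sum (λ i → as i * φ (n ∸ 2 ℕ.* index i) x) + (a * φ n x + sum (λ i → φ (n ℕ.+ 2 ℕ.* index i) (as i * x)))
      ≈⟨ trans (sym (+-assoc _ _ _)) (trans (+-congʳ (+-comm _ _)) (+-assoc _ _ _)) ⟩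
    a * φ n x + (sum (λ i → as i * φ (n ∸ 2 ℕ.* index i) x) + sum (λ i → φ (n ℕ.+ 2 ℕ.* index i) (as i * x)))
      ≈⟨ +-congˡ (∑-distrib-+ (λ i → as i * φ (n ∸ 2 ℕ.* index i) x) _) ⟨
    a * φ n x + sum (λ i → as i * φ (n ∸ 2 ℕ.* index i) x + φ (n ℕ.+ 2 ℕ.* index i) (as i * x)) ∎
    where
    open +-*-Solver
    high-coefficients : Vector Carrier (suc e)
    high-coefficients = a ∷ λ i → φ (n ℕ.+ 2 ℕ.* index i) (as i)
    φ-φ-d : ∀ k m → d ℕ.+ 2 ℕ.* k ≡ m → φ (2 ℕ.* k) (φ d x) ≈ φ m x
    φ-φ-d k m eq = trans (φ-φ (2 ℕ.* k) d x) (φ-≡ x (≡.trans (ℕ.+-comm _ d) eq))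
    low : sum (λ i → coefficients a as (i ↑ˡ suc e) * φ (2 ℕ.* toℕ (i ↑ˡ suc e)) (φ d x))
      ≈ sum (λ i → as i * φ (n ∸ 2 ℕ.* index i) x)
    low = trans
      (sum-cong-≋ λ i → *-cong (reflexive (lookup-++ˡ (as ∘ opposite) high-coefficients i))
        (φ-φ-d (toℕ (i ↑ˡ suc e)) _ (≡.trans (≡.cong (λ k → d ℕ.+ 2 ℕ.* k)
          (≡.trans (Fin.toℕ-↑ˡ i (suc e)) (≡.cong toℕ (≡.sym (Fin.opposite-involutive i)))))
          (≡.sym (n∸2index (opposite i))))))
      (sym (sum-permute (λ i → as i * φ (n ∸ 2 ℕ.* index i) x) reverse))
    middle : coefficients a as (e ↑ʳ zero) * φ (2 ℕ.* toℕ (e ↑ʳ zero {e})) (φ d x) ≈ a * φ n x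
    middle = *-cong (reflexive (lookup-++ʳ (as ∘ opposite) high-coefficients zero))
      (φ-φ-d (toℕ (e ↑ʳ zero {e})) n (≡.trans (≡.cong (λ k → d ℕ.+ 2 ℕ.* k)
        (≡.trans (Fin.toℕ-↑ʳ e (zero {e})) (ℕ.+-identityʳ e))) (≡.sym n≡d+2e)))
    high : ∀ i → coefficients a as (e ↑ʳ suc i) * φ (2 ℕ.* toℕ (e ↑ʳ suc i)) (φ d x) ≈ φ (n ℕ.+ 2 ℕ.* index i) (as i * x)
    high i = trans (*-cong (reflexive (lookup-++ʳ (as ∘ opposite) high-coefficients (suc i)))
      (φ-φ-d (toℕ (e ↑ʳ suc i)) (n ℕ.+ 2 ℕ.* index i) (≡.trans (≡.cong (λ k → d ℕ.+ 2 ℕ.* k) (Fin.toℕ-↑ʳ e (suc i)))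
        (≡.trans (solve 3 (λ d e i → d :+ con 2 :* (e :+ i) := d :+ con 2 :* e :+ con 2 :* i) ≡.refl d e (index i))
          (≡.cong (ℕ._+ 2 ℕ.* index i) (≡.sym n≡d+2e))))))
      (sym (φ-* (n ℕ.+ 2 ℕ.* index i) (as i) x))

  Tr-S≈Tr-L : ∀ a as y x → Tr (S a as y x) ≈ Tr (y * L a as x)
  Tr-S≈Tr-L a as y x = begin
    Tr (S a as y x)
      ≈⟨ Tr-S a as y x ⟩
    Tr (T a y x) + sum (λ i → Tr (U i (as i) y x) + Tr (W i (as i) y x))
      ≈⟨ +-cong (Tr-cong (xy∙z≈y∙xz a y _)) (sum-cong-≋ λ i → trans
           (+-cong (Tr-cong (xy∙z≈y∙xz (as i) y _)) (W-term i)) (sym (Tr-+ _ _))) ⟩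
    Tr (y * (a * φ n x)) + sum (λ i → Tr (y * u i + y * w i))
      ≈⟨ +-congˡ (sum-cong-≋ {e} λ i → Tr-cong (sym (distribˡ y (u i) (w i)))) ⟩
    Tr (y * (a * φ n x)) + sum (λ i → Tr (y * (u i + w i)))
      ≈⟨ +-congˡ (trans (Tr-cong (*-distribˡ-sum y (λ i → u i + w i))) (Tr-sum (λ i → y * (u i + w i)))) ⟨
    Tr (y * (a * φ n x)) + Tr (y * sum (λ i → u i + w i))
      ≈⟨ trans (Tr-cong (distribˡ y _ _)) (Tr-+ _ _) ⟨
    Tr (y * (a * φ n x + sum (λ i → u i + w i)))
      ≈⟨ Tr-cong (*-congˡ (L-expand a as x)) ⟨
    Tr (y * L a as x) ∎
    where
    u w : Fin e → Carrier
    u i = as i * φ (n ∸ 2 ℕ.* index i) x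
    w i = φ (n ℕ.+ 2 ℕ.* index i) (as i * x)
    -- The exponent `n + 2j` is odd like 1, and it completes the `n - 2j` on `y` to `2n`, which
    -- leaves `y` bare.
    W-term : ∀ i → Tr (W i (as i) y x) ≈ Tr (y * w i)
    W-term i = begin
      Tr (W i (as i) y x)        ≈⟨ Tr-cong (φ₁-U i (as i) x y) ⟨
      Tr (φ 1 (U i (as i) x y))  ≈⟨ Tr-φ-odd (proj₁ n-odd ℕ.+ index i) _ _ (≡.trans (≡.cong (ℕ._+ 2 ℕ.* index i) (proj₂ n-odd))
                                      (solve 2 (λ k i → con 2 :* k :+ con 1 :+ con 2 :* i := con 2 :* (k :+ i) :+ con 1)
                                        ≡.refl (proj₁ n-odd) (index i))) ⟨
      Tr (φ (n ℕ.+ 2 ℕ.* index i) (U i (as i) x y)) ≈⟨ Tr-cong (φ-* (n ℕ.+ 2 ℕ.* index i) _ _) ⟩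
      Tr (w i * φ (n ℕ.+ 2 ℕ.* index i) (φ (n ∸ 2 ℕ.* index i) y))
        ≈⟨ Tr-cong (*-congˡ (trans (φ-φ (n ℕ.+ 2 ℕ.* index i) _ y) (trans (φ-≡ y (n+2index+[n∸2index] i)) (φ-2n y)))) ⟩
      Tr (w i * y)               ≈⟨ Tr-cong (*-comm _ _) ⟩
      Tr (y * w i)               ∎
      where open +-*-Solver

  -- Nondegeneracy of the trace form and vanishing of the parameters

  trace-nondegenerate : (ξ : Vector Carrier n) → LinInd ξ → ∀ x → (∀ j → Tr (ξ j * x) ≈ 0#) → x ≈ 0#
  trace-nondegenerate ξ ind x Tr≈0 = ^≈0⇒≈0 (q ℕ.^ (2 ℕ.* toℕ i₀)) (lin≈0⇒coefficients≈0 ℕ.≤-refl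
    (λ k → φ (2 ℕ.* toℕ k) x) ξ ind (λ j → trans (sum-cong-≋ {n} λ k →
      trans (sym (φ-* (2 ℕ.* toℕ k) x (ξ j))) (φ-cong (2 ℕ.* toℕ k) (*-comm x (ξ j)))) (Tr≈0 j)) i₀)
    where
    -- Index 0, which exists because `n` is positive. The coefficient read off there is a power of
    -- `x`, so its vanishing passes to `x`.
    i₀ : Fin n
    i₀ = fromℕ< (ℕ.≤-trans 1≤d d≤n)

  -- `φ d` is only semilinear over `E`. Applying its inverse `φ (2 * n ∸ d)` to a relation gives a
  -- relation among the `z l`, whose coefficients stay in `E` as powers of elements of `E`.
  φ-independent : ∀ {m} (z : Vector Carrier m) → LinInd z → LinInd (φ d ∘ z)
  φ-independent {m} z ind s eq = λ l → ^≈0⇒≈0 (q ℕ.^ D) (ind s′ s′z≈0 l)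
    where
    D = 2 ℕ.* n ∸ d
    s′ : Vector (Field.Carrier 𝔽q²) m
    s′ l = φ D (proj₁ (s l)) , SubfieldProperties.^-closed F E (q ℕ.^ D) (proj₂ (s l))
    D+d≡2n : D ℕ.+ d ≡ 2 ℕ.* n
    D+d≡2n = ℕ.m∸n+n≡m (ℕ.≤-trans d≤n (ℕ.m≤m+n n _))
    s′z≈0 : sum (λ l → φ D (proj₁ (s l)) * z l) ≈ 0#
    s′z≈0 = begin
      sum (λ l → φ D (proj₁ (s l)) * z l)          ≈⟨ sum-cong-≋ (λ l → trans (φ-* D _ _)
                                                        (*-congˡ (trans (φ-φ D d (z l)) (trans (φ-≡ (z l) D+d≡2n) (φ-2n (z l)))))) ⟨
      sum (λ l → φ D (proj₁ (s l) * φ d (z l)))    ≈⟨ φ-sum D (λ l → proj₁ (s l) * φ d (z l)) ⟨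
      φ D (sum (λ l → proj₁ (s l) * φ d (z l)))    ≈⟨ φ-cong D eq ⟩
      φ D 0#                                       ≈⟨ φ-0# D ⟩
      0#                                           ∎

  -- Here `ξ` tests the trace form and `z` tests `L`. Taking `ξ` for `z` shows that a form
  -- determines its parameters; taking independent vectors of the radical for `z` gives the rank
  -- bound.
  form≈0⇒parameters≈0 : (ξ : Vector Carrier n) → LinInd ξ → ∀ {m} (z : Vector Carrier m) → LinInd z →
    e ℕ.+ suc e ℕ.≤ m → ∀ a as → (∀ j l → Tr (S a as (ξ j) (z l)) ≈ 0#) → a ≈ 0# × ∀ i → as i ≈ 0#
  form≈0⇒parameters≈0 ξ ξ-ind z z-ind 2e+1≤m a as S≈0 =
    trans (reflexive (≡.sym (lookup-++ʳ (as ∘ opposite) high-coefficients zero))) (coefficients≈0 (e ↑ʳ zero)) ,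
    λ i → trans (reflexive (≡.sym (≡.trans (lookup-++ˡ (as ∘ opposite) high-coefficients (opposite i))
      (≡.cong as (Fin.opposite-involutive i))))) (coefficients≈0 (opposite i ↑ˡ suc e))
    where
    high-coefficients : Vector Carrier (suc e)
    high-coefficients = a ∷ λ i → φ (n ℕ.+ 2 ℕ.* index i) (as i)
    coefficients≈0 : ∀ i → coefficients a as i ≈ 0#
    coefficients≈0 = lin≈0⇒coefficients≈0 2e+1≤m (coefficients a as) (φ d ∘ z) (φ-independent z z-ind) λ l →
      trace-nondegenerate ξ ξ-ind _ λ j → trans (sym (Tr-S≈Tr-L a as (ξ j) (z l))) (S≈0 j l)

-- Encoding of functions and the count of radical vectors

funToFin-cong : ∀ {m n} {f g : Fin m → Fin n} → f ≗ g → funToFin f ≡ funToFin g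
funToFin-cong {zero}  f≗g = ≡.refl
funToFin-cong {suc m} f≗g = ≡.cong₂ combine (f≗g zero) (funToFin-cong (f≗g ∘ suc))

funToFin-injective : ∀ {m n} (f g : Fin m → Fin n) → funToFin f ≡ funToFin g → f ≗ g
funToFin-injective f g eq i = ≡.trans (≡.sym (Fin.finToFun-funToFin f i))
  (≡.trans (≡.cong (λ k → finToFun k i) eq) (Fin.finToFun-funToFin g i))

-- For a rank `r` and nullity `m`, falling short of `d` by at least one leaves
-- `m ≥ n - d + 1 = 2e + 1`.
2e+1≤n∸r : ∀ {n d e r m} → n ≡ d ℕ.+ 2 ℕ.* e → r ℕ.+ m ≡ n → r ℕ.< d → e ℕ.+ suc e ℕ.≤ m
2e+1≤n∸r {n} {d} {e} {r} {m} n≡d+2e r+m≡n r<d = ℕ.+-cancelˡ-≤ r _ _ (begin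
  r ℕ.+ (e ℕ.+ suc e)    ≡⟨ solve 2 (λ r e → r :+ (e :+ (con 1 :+ e)) := con 1 :+ r :+ con 2 :* e) ≡.refl r e ⟩
  suc r ℕ.+ 2 ℕ.* e      ≤⟨ ℕ.+-monoˡ-≤ (2 ℕ.* e) r<d ⟩
  d ℕ.+ 2 ℕ.* e          ≡⟨ n≡d+2e ⟨
  n                      ≡⟨ r+m≡n ⟨
  r ℕ.+ m                ∎)
  where
  open ℕ.≤-Reasoning
  open +-*-Solver

-- The code: additivity, size and minimum distance

module Code (q n d : ℕ) (primePower : IsPrimePower q)
    (n-odd : Odd n) (d-odd : Odd d) (1≤d : 1 ℕ.≤ d) (d≤n : d ℕ.≤ n)
    (F : Field c ℓ) (E : Subfield F p₁) (K : Subfield F p₂)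
    (order  : HasOrder F (q ℕ.^ (2 ℕ.* n)))
    (orderᴱ : HasOrder (Subfield.asField E) (q ℕ.^ 2))
    (orderᴷ : HasOrder (Subfield.asField K) (q ℕ.^ n)) where
  open Field F hiding (zero)
  open Exp commutativeSemiring using (_^_; ^-congˡ)
  open GroupProperties +-group using (inverseʳ-unique; x∙y⁻¹≈ε⇒x≈y; identityʳ-unique)
  open MonoidSum +-commutativeMonoid using (sum; sum-cong-≋)
  open SetoidReasoning setoid
  open HermitianForms q n d primePower n-odd d-odd 1≤d d≤n F E K order orderᴱ orderᴷ
  open Construction F E K q n d using (Y; IsHermitianForm; matrixSpace; coordinateSpace;
    Matrix; X; HasRank; matrixOf; IsCode; IsAdditive; HasCardinality)
  open Params
  private
    module 𝔼 = Field 𝔽q²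
    module 𝔽ᶠ = FiniteField F order
    module 𝕂 = Field (Subfield.asField K)
    module 𝕂ᶠ = FiniteField (Subfield.asField K) orderᴷ
    module 𝔼ᶠ = FiniteField 𝔽q² orderᴱ

  form : Params → Carrier → Carrier → 𝔼.Carrier
  form θ x y = H θ x y , Tr∈E _

  H-+ : ∀ θ x x′ y → H θ (x + x′) y ≈ H θ x y + H θ x′ y
  H-+ θ x x′ y = trans (Tr-cong (S-+ (proj₁ (a₀ θ)) (as θ) x x′ y)) (Tr-+ _ _)

  H-* : ∀ θ {s} x y → s ∈ Subfield.Member E → H θ (s * x) y ≈ s * H θ x y
  H-* θ x y s∈ = trans (Tr-cong (S-* (proj₁ (a₀ θ)) (as θ) x y s∈)) (Tr-* _ s∈)

  H-hermitian : ∀ θ x y → H θ y x ≈ H θ x y ^ q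
  H-hermitian θ x y = Tr-S-hermitian (as θ) x y (K-fixed (proj₂ (a₀ θ)))

  H-0ˡ : ∀ θ y → H θ 0# y ≈ 0#
  H-0ˡ θ y = identityʳ-unique _ _ (trans (sym (H-+ θ 0# 0# y)) (Tr-cong
    (S-cong {proj₁ (a₀ θ)} {as = as θ} refl (λ _ → refl) (+-identityˡ 0#) refl)))

  H-lc : ∀ θ {m} (s : Vector 𝔼.Carrier m) (z : Vector Carrier m) y →
    H θ (linearCombination 𝔽q² V s z) y ≈ sum (λ i → proj₁ (s i) * H θ (z i) y)
  H-lc θ {zero}  s z y = H-0ˡ θ y
  H-lc θ {suc m} s z y = trans (H-+ θ _ _ y)
    (+-cong (H-* θ (z zero) y (proj₂ (s zero))) (H-lc θ (s ∘ suc) (z ∘ suc) y))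

  form-hermitian : ∀ θ → IsHermitianForm V (form θ)
  form-hermitian θ = record
    { cong        = λ x≈ y≈ → Tr-cong (S-cong {proj₁ (a₀ θ)} {as = as θ} refl (λ _ → refl) x≈ y≈)
    ; additive    = H-+ θ
    ; homogeneous = λ s x y → H-* θ x y (proj₂ s)
    ; hermitian   = λ x y → trans (H-hermitian θ x y)
        (reflexive (≡.sym (SubfieldProperties.proj₁-^ F E (form θ x y) q)))
    }

  _≈ᶿ_ : Params → Params → Set _
  θ ≈ᶿ θ′ = proj₁ (a₀ θ) ≈ proj₁ (a₀ θ′) × ∀ i → as θ i ≈ as θ′ i

  H-congᶿ : ∀ {θ θ′} x y → θ ≈ᶿ θ′ → H θ x y ≈ H θ′ x y
  H-congᶿ x y (a₀≈ , as≈) = Tr-cong (S-cong a₀≈ as≈ refl refl)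

  _+ᶿ_ : Params → Params → Params
  θ +ᶿ θ′ = record { a₀ = a₀ θ 𝕂.+ a₀ θ′ ; as = λ i → as θ i + as θ′ i }

  -ᶿ_ : Params → Params
  -ᶿ θ = record { a₀ = 𝕂.- a₀ θ ; as = λ i → - as θ i }

  0ᶿ : Params
  0ᶿ = record { a₀ = 𝕂.0# ; as = λ _ → 0# }

  H-+ᶿ : ∀ θ θ′ x y → H (θ +ᶿ θ′) x y ≈ H θ x y + H θ′ x y
  H-+ᶿ θ θ′ x y = trans (Tr-cong (S-+ᶿ (proj₁ (a₀ θ)) (proj₁ (a₀ θ′)) (as θ) (as θ′) x y)) (Tr-+ _ _)

  H-0ᶿ : ∀ x y → H 0ᶿ x y ≈ 0#
  H-0ᶿ x y = identityʳ-unique _ _ (trans (sym (H-+ᶿ 0ᶿ 0ᶿ x y))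
    (H-congᶿ {0ᶿ +ᶿ 0ᶿ} {0ᶿ} x y (+-identityˡ 0# , λ _ → +-identityˡ 0#)))

  H--ᶿ : ∀ θ x y → H (-ᶿ θ) x y ≈ - H θ x y
  H--ᶿ θ x y = inverseʳ-unique _ _ (trans (sym (H-+ᶿ θ (-ᶿ θ) x y))
    (trans (H-congᶿ {θ +ᶿ (-ᶿ θ)} {0ᶿ} x y (-‿inverseʳ _ , λ _ → -‿inverseʳ _)) (H-0ᶿ x y)))

  parameterCount : ℕ
  parameterCount = q ℕ.^ n ℕ.* (q ℕ.^ (2 ℕ.* n)) ℕ.^ e

  encode : Params → Fin parameterCount
  encode θ = combine (𝕂ᶠ.index (a₀ θ)) (funToFin (𝔽ᶠ.index ∘ as θ))

  encode-cong : ∀ {θ θ′} → θ ≈ᶿ θ′ → encode θ ≡ encode θ′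
  encode-cong (a₀≈ , as≈) = ≡.cong₂ combine (𝕂ᶠ.cong a₀≈) (funToFin-cong (𝔽ᶠ.cong ∘ as≈))

  encode-injective : ∀ {θ θ′} → encode θ ≡ encode θ′ → θ ≈ᶿ θ′
  encode-injective {θ} {θ′} eq =
    let (eq₀ , eqₛ) = Fin.combine-injective (𝕂ᶠ.index (a₀ θ)) _ (𝕂ᶠ.index (a₀ θ′)) _ eq
    in 𝕂ᶠ.injective eq₀ , λ i → 𝔽ᶠ.injective (funToFin-injective (𝔽ᶠ.index ∘ as θ) (𝔽ᶠ.index ∘ as θ′) eqₛ i)

  decode : Fin parameterCount → Params
  decode i = let (j , k) = remQuot {q ℕ.^ n} ((q ℕ.^ (2 ℕ.* n)) ℕ.^ e) i in
    record { a₀ = 𝕂ᶠ.enum j ; as = 𝔽ᶠ.enum ∘ finToFun k }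

  encode-decode : ∀ i → encode (decode i) ≡ i
  encode-decode i = ≡.trans
    (≡.cong₂ combine (𝕂ᶠ.index-enum _) (≡.trans (funToFin-cong {e} (λ l → 𝔽ᶠ.index-enum (finToFun k l)))
      (Fin.funToFin-finToFin {e} k)))
    (Fin.combine-remQuot {q ℕ.^ n} ((q ℕ.^ (2 ℕ.* n)) ℕ.^ e) i)
    where k = proj₂ (remQuot {q ℕ.^ n} ((q ℕ.^ (2 ℕ.* n)) ℕ.^ e) i)

  parameterCount≡ : parameterCount ≡ q ℕ.^ (n ℕ.* (n ∸ d ℕ.+ 1))
  parameterCount≡ = ≡.trans (≡.cong (q ℕ.^ n ℕ.*_) (ℕ.^-*-assoc q (2 ℕ.* n) e))
    (≡.trans (≡.sym (ℕ.^-distribˡ-+-* q n (2 ℕ.* n ℕ.* e))) (≡.cong (q ℕ.^_)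
    (≡.trans (solve 2 (λ n e → n :+ con 2 :* n :* e := n :* (con 2 :* e :+ con 1)) ≡.refl n e)
      (≡.cong (λ k → n ℕ.* (k ℕ.+ 1)) 2e≡n∸d))))
    where
    open +-*-Solver
    2e≡n∸d : 2 ℕ.* e ≡ n ∸ d
    2e≡n∸d = ≡.sym (≡.trans (≡.cong (_∸ d) n≡d+2e) (ℕ.m+n∸m≡n d _))

  module _ (ξ : Vector Carrier n) (basis : IsBasis 𝔽q² V ξ) where
    open LeftModule (matrixSpace n) using (_≈ᴹ_; _+ᴹ_; -ᴹ_; 0ᴹ)
    private ξ-independent = proj₁ basis

    represents : ∀ A θ → (∀ i j → proj₁ (A i j) ≈ H θ (ξ i) (ξ j)) → A ∈ Y ξ
    represents A θ A≈ = θ , form θ , (λ _ _ → refl) , A≈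

    parameters : ∀ {A} → A ∈ Y ξ → Params
    parameters = proj₁

    entry : ∀ {A} (A∈ : A ∈ Y ξ) i j → proj₁ (A i j) ≈ H (parameters {A} A∈) (ξ i) (ξ j)
    entry (θ , B , B≈ , A≈) i j = trans (A≈ i j) (B≈ (ξ i) (ξ j))

    -- Additivity in the parameters reduces the distance between two members to the rank of a single
    -- form.
    difference-entry : ∀ {A B} (A∈ : A ∈ Y ξ) (B∈ : B ∈ Y ξ) i j →
      proj₁ ((A +ᴹ (-ᴹ B)) i j) ≈ H (parameters {A} A∈ +ᶿ (-ᶿ parameters {B} B∈)) (ξ i) (ξ j)
    difference-entry {A} {B} A∈ B∈ i j = trans (+-cong (entry {A} A∈ i j)
      (trans (-‿cong (entry {B} B∈ i j)) (sym (H--ᶿ (parameters {B} B∈) (ξ i) (ξ j)))))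
      (sym (H-+ᶿ (parameters {A} A∈) (-ᶿ parameters {B} B∈) (ξ i) (ξ j)))

    hermitian : ∀ {A} → A ∈ Y ξ → A ∈ X n
    hermitian {A} A∈ i j = begin
      proj₁ (A j i)                        ≈⟨ entry {A} A∈ j i ⟩
      H θ (ξ j) (ξ i)                      ≈⟨ H-hermitian θ (ξ i) (ξ j) ⟩
      H θ (ξ i) (ξ j) ^ q                  ≈⟨ ^-congˡ q (entry {A} A∈ i j) ⟨
      proj₁ (A i j) ^ q                    ≡⟨ SubfieldProperties.proj₁-^ F E (A i j) q ⟨
      proj₁ (Exp._^_ 𝔼.commutativeSemiring (A i j) q) ∎
      where θ = parameters {A} A∈

    additive : IsAdditive (Y ξ)
    additive = record
      { zero-closed = represents 0ᴹ 0ᶿ (λ i j → sym (H-0ᶿ (ξ i) (ξ j)))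
      ; +-closed    = λ A B A∈ B∈ → represents (A +ᴹ B) (parameters {A} A∈ +ᶿ parameters {B} B∈)
          (λ i j → trans (+-cong (entry {A} A∈ i j) (entry {B} B∈ i j))
            (sym (H-+ᶿ (parameters {A} A∈) (parameters {B} B∈) (ξ i) (ξ j))))
      ; neg-closed  = λ A A∈ → represents (-ᴹ A) (-ᶿ parameters {A} A∈)
          (λ i j → trans (-‿cong (entry {A} A∈ i j)) (sym (H--ᶿ (parameters {A} A∈) (ξ i) (ξ j))))
      }

    -- The difference form vanishes on all pairs of basis vectors, and `2e+1≤n∸r` at `r = 0` shows
    -- that `ξ` is long enough to force its parameters to zero; `1 ≤ d` is the bound used there.
    parameters-injective : ∀ {A B} (A∈ : A ∈ Y ξ) (B∈ : B ∈ Y ξ) → A ≈ᴹ B → parameters {A} A∈ ≈ᶿ parameters {B} B∈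
    parameters-injective {A} {B} A∈ B∈ A≈B =
      let (a≈0 , as≈0) = form≈0⇒parameters≈0 ξ ξ-independent ξ ξ-independent (2e+1≤n∸r n≡d+2e ≡.refl 1≤d)
            (proj₁ (a₀ (θ +ᶿ (-ᶿ θ′)))) (as (θ +ᶿ (-ᶿ θ′))) (λ j l →
              trans (sym (difference-entry {A} {B} A∈ B∈ j l)) (trans (+-congʳ (A≈B j l)) (-‿inverseʳ _)))
      in x∙y⁻¹≈ε⇒x≈y _ _ a≈0 , λ i → x∙y⁻¹≈ε⇒x≈y _ _ (as≈0 i)
      where
      θ = parameters {A} A∈
      θ′ = parameters {B} B∈

    -- `encode` is applied to the parameters stored in the membership proof. Equality of members
    -- ignores that proof, so the hard half is that the map respects equality, which is
    -- `parameters-injective`; injectivity merely says that parameters determine the matrix.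
    cardinality : HasCardinality (Y ξ) (q ℕ.^ (n ℕ.* (n ∸ d ℕ.+ 1)))
    cardinality = ≡.subst (HasCardinality (Y ξ)) parameterCount≡ (record
      { to        = λ (A , A∈) → encode (parameters {A} A∈)
      ; cong      = λ { {A , A∈} {B , B∈} → cong A A∈ B B∈ }
      ; bijective =
          (λ { {A , A∈} {B , B∈} eq i j → trans (entry {A} A∈ i j) (trans
            (H-congᶿ {parameters {A} A∈} {parameters {B} B∈} (ξ i) (ξ j)
              (encode-injective {parameters {A} A∈} {parameters {B} B∈} eq))
            (sym (entry {B} B∈ i j))) })
        , λ i → (matrix (decode i) , matrix∈Y (decode i)) , λ { {A , A∈} A≈ →
            ≡.trans (cong A A∈ (matrix (decode i)) (matrix∈Y (decode i)) A≈) (encode-decode i) }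
      })
      where
      matrix : Params → Matrix n
      matrix θ = matrixOf ξ (form θ)
      matrix∈Y : ∀ θ → matrix θ ∈ Y ξ
      matrix∈Y θ = represents (matrix θ) θ (λ _ _ → refl)
      cong : ∀ A (A∈ : A ∈ Y ξ) B (B∈ : B ∈ Y ξ) → A ≈ᴹ B → encode (parameters {A} A∈) ≡ encode (parameters {B} B∈)
      cong A A∈ B B∈ A≈B = encode-cong {parameters {A} A∈} {parameters {B} B∈} (parameters-injective {A} {B} A∈ B∈ A≈B)

    lc-entry : ∀ {m} (s : Vector 𝔼.Carrier m) (A : Vector (Vector 𝔼.Carrier n) m) j →
      proj₁ (linearCombination 𝔽q² (coordinateSpace n) s A j) ≈ sum (λ i → proj₁ (s i) * proj₁ (A i j))
    lc-entry {zero}  s A j = refl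
    lc-entry {suc m} s A j = +-congˡ (lc-entry (s ∘ suc) (A ∘ suc) j)

    -- The linear relations between the rows of the matrix of H θ span the radical of H θ.
    -- If the rank were less than d, the radical would contain 2e + 1 = n - d + 1 independent vectors.
    distance : ∀ A B → A ∈ Y ξ → B ∈ Y ξ → ¬ (A ≈ᴹ B) → ∃ λ r → HasRank (A +ᴹ (-ᴹ B)) r × d ℕ.≤ r
    distance A B A∈ B∈ A≉B = rank , (D ∘ pivot , independent , (λ i → lc-unit D (pivot i)) , spanning) , d≤rank
      where
      D : Matrix n
      D = A +ᴹ (-ᴹ B)
      θ = parameters {A} A∈ +ᶿ (-ᶿ parameters {B} B∈)
      D-entry : ∀ i j → proj₁ (D i j) ≈ H θ (ξ i) (ξ j)
      D-entry = difference-entry {A} {B} A∈ B∈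
      open LinearCombination 𝔽q² (coordinateSpace n) using (lc-unit; module RankNullity)
      open FiniteLinearAlgebra 𝔽q² orderᴱ (coordinateSpace n) (λ u v → Fin.all? λ i → u i 𝔼ᶠ.≟ v i)
      open RankNullity (rankNullity D)
      z : Vector Carrier nullity
      z l = linearCombination 𝔽q² V (relation l) ξ
      -- `lc-lc` turns a dependence of `z` into one of `ξ`, whose coefficients are the coordinates
      -- of a dependence of the relations.
      z-independent : LinInd z
      z-independent t tz≈0 = relation-independent t (ξ-independent
        (λ i → MonoidSum.sum 𝔼.+-commutativeMonoid (λ l → t l 𝔼.* relation l i))
        (trans (sym (LinearCombination.lc-lc 𝔽q² V t relation ξ)) tz≈0))
      H-z≈0 : ∀ j l → H θ (z l) (ξ j) ≈ 0#
      H-z≈0 j l = begin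
        H θ (z l) (ξ j)
          ≈⟨ H-lc θ (relation l) ξ (ξ j) ⟩
        sum (λ i → proj₁ (relation l i) * H θ (ξ i) (ξ j))
          ≈⟨ sum-cong-≋ {n} (λ i → *-congˡ {proj₁ (relation l i)} (D-entry i j)) ⟨
        sum (λ i → proj₁ (relation l i) * proj₁ (D i j))
          ≈⟨ lc-entry (relation l) D j ⟨
        proj₁ (linearCombination 𝔽q² (coordinateSpace n) (relation l) D j)
          ≈⟨ relation≈0 l j ⟩
        0# ∎
      -- Row relations act on the first argument of `H`, whereas `L` is evaluated at the second;
      -- Hermitian symmetry exchanges them.
      z-radical : ∀ j l → H θ (ξ j) (z l) ≈ 0#
      z-radical j l = begin
        H θ (ξ j) (z l)      ≈⟨ H-hermitian θ (z l) (ξ j) ⟩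
        H θ (z l) (ξ j) ^ q  ≈⟨ ^-congˡ q (H-z≈0 j l) ⟩
        0# ^ q               ≈⟨ φ₁ 0# ⟨
        φ 1 0#               ≈⟨ φ-0# 1 ⟩
        0#                   ∎
      -- The bound is decidable, so the negative hypothesis `A≉B` suffices: its failure would force
      -- the difference parameters to vanish.
      d≤rank : d ℕ.≤ rank
      d≤rank with d ℕ.≤? rank
      ... | yes d≤r = d≤r
      ... | no  d≰r = contradiction A≈B A≉B
        where
        A≈B : A ≈ᴹ B
        A≈B i j = x∙y⁻¹≈ε⇒x≈y _ _ (trans (D-entry i j) (trans
          (H-congᶿ {θ} {0ᶿ} (ξ i) (ξ j) (form≈0⇒parameters≈0 ξ ξ-independent z z-independent
            (2e+1≤n∸r n≡d+2e rank+nullity (ℕ.≰⇒> d≰r))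
            (proj₁ (a₀ θ)) (as θ) z-radical))
          (H-0ᶿ (ξ i) (ξ j))))

    isCode : IsCode d (Y ξ)
    isCode = record
      { hermitian = λ {A} → hermitian {A}
      ; nonempty  = 0ᴹ , IsAdditive.zero-closed additive
      ; distance  = distance
      }

open import Data.Nat.Base using (_+_; _*_; _^_; _≤_)

theorem4p2 : ∀ {c ℓ p₁ p₂} (q n d : ℕ) →
    IsPrimePower q → Odd n → Odd d → 1 ≤ d → d ≤ n →
    (F : Field c ℓ) (E : Subfield F p₁) (K : Subfield F p₂) →
    HasOrder F (q ^ (2 * n)) →
    HasOrder (Subfield.asField E) (q ^ 2) →
    HasOrder (Subfield.asField K) (q ^ n) →
    let open Construction F E K q n d in
    (∀ θ → ∃ λ B → Realises B θ × IsHermitianForm V B)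
    × (∀ (ξ : Vector (Field.Carrier F) n) → IsBasis 𝔽q² V ξ →
    IsCode d (Y ξ)
    × IsAdditive (Y ξ)
    × HasCardinality (Y ξ) (q ^ (n * (n ∸ d + 1))))
theorem4p2 q n d primePower n-odd d-odd 1≤d d≤n F E K order orderᴱ orderᴷ =
  (λ θ → form θ , (λ _ _ → Field.refl F) , form-hermitian θ) ,
  (λ ξ basis → isCode ξ basis , additive ξ basis , cardinality ξ basis)
  where open Code q n d primePower n-odd d-odd 1≤d d≤n F E K order orderᴱ orderᴷ
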